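{- Let $n,k$ be integers with $1\le k\le n-1$ and let $G\in\mathscr{Q}(n,k)$. Then $$SO(G)\le (n-k-1)\sqrt{(n-1)^2+1}+(k-1)\left(\sqrt{k^2+4}+\sqrt{(n-1)^2+4}\right)+\sqrt{k^2+(n-1)^2},$$ with equality if and only if $G\cong Q_{n,k}$.
   Context: All graphs are finite, simple and undirected; $d_G(v)$ is the degree of the vertex $v$ in $G$. The Sombor index of $G$ is $SO(G)=\sum_{uv\in E(G)}\sqrt{d_G(u)^2+d_G(v)^2}$. A connected graph $G$ is a quasi-tree if there is a vertex $u\in V(G)$ such that $G-u$ is a tree. $\mathscr{Q}(n,k)$ denotes the set of quasi-tree graphs $G$ of order $n$ having a vertex $u$ such that $G-u$ is a tree and $d_G(u)=k$ (so $k\ge 1$). $S_m\cong K_{1,m-1}$ is the star of order $m$. $Q_{n,k}$ ($1\le k\le n-1$) is the graph of order $n$ obtained from the star $S_{n-1}$ and a new vertex $v$ by joining $v$ to the center (the $(n-2)$-degree vertex) of $S_{n-1}$ and to $k-1$ of the leaves of $S_{n-1}$. -}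

module Defs where

open import Algebra.Bundles using (CommutativeMonoid)
open import Data.Empty using (⊥)
open import Data.Fin as Fin using (Fin; zero; suc; toℕ; punchIn)
import Data.Fin.Properties as Fin
open import Data.Integer as ℤ using (+_; +[1+_])
import Data.Integer.Properties as ℤ
open import Data.Integer.Tactic.RingSolver using (solve-∀)
open import Data.List using (List; []; _∷_; _++_; allFin; cartesianProduct; filter; foldr; length; map)
open import Data.List.Relation.Unary.Linked using (Linked)
open import Data.List.Relation.Unary.Unique.Propositional using (Unique)
open import Data.Nat as ℕ using (ℕ; zero; suc; _+_; _*_; _∸_; _^_; _≤_; _<_; z≤n; s≤s; _⊔_)
import Data.Nat.Properties as ℕ
import Data.Nat.Solver as ℕSolver
open import Data.Product using (_×_; _,_; proj₁; proj₂; ∃-syntax)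
open import Data.Rational.Unnormalised as ℚ using (ℚᵘ; mkℚᵘ; 0ℚᵘ; 1ℚᵘ; ½; ∣_∣; *≤*; *≡*; *<*)
import Data.Rational.Unnormalised.Properties as ℚ
open import Data.Sum using (inj₁; inj₂)
open import Data.Unit using (⊤; tt)
open import Function using (_↔_; _⇔_; Inverse)
open import Level using (0ℓ)
open import Relation.Binary using (Rel; Decidable; Irreflexive; Symmetric)
open import Relation.Binary.Construct.Closure.ReflexiveTransitive using (Star)
open import Relation.Binary.PropositionalEquality using (_≡_; refl; sym; cong; subst₂)
open import Relation.Nullary using (¬_; yes; no)
open import Relation.Nullary.Decidable using (_×-dec_)
open import Relation.Unary as U using (Pred)

-- Cauchy sequences of rationals; equality of the reals they represent is _≈ℝ_.
record ℝ : Set where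
  field
    seq    : ℕ → ℚᵘ
    cauchy : ∀ ε → 0ℚᵘ ℚ.< ε →
             ∃[ N ] (∀ m n → N ≤ m → N ≤ n → ∣ seq m ℚ.- seq n ∣ ℚ.≤ ε)

open ℝ public

infix 4 _≤ℝ_ _≈ℝ_

_≤ℝ_ : Rel ℝ 0ℓ
x ≤ℝ y = ∀ ε → 0ℚᵘ ℚ.< ε → ∃[ N ] (∀ n → N ≤ n → seq x n ℚ.≤ seq y n ℚ.+ ε)

_≈ℝ_ : Rel ℝ 0ℓ
x ≈ℝ y = ∀ ε → 0ℚᵘ ℚ.< ε → ∃[ N ] (∀ n → N ≤ n → ∣ seq x n ℚ.- seq y n ∣ ℚ.≤ ε)

ε/2>0 : ∀ ε → 0ℚᵘ ℚ.< ε → 0ℚᵘ ℚ.< ½ ℚ.* ε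
ε/2>0 ε ε>0 =
  ℚ.<-respˡ-≃ (ℚ.*-zeroʳ ½) (ℚ.*-monoʳ-<-pos ½ ε>0)

ε/2+ε/2≃ε : ∀ ε → ½ ℚ.* ε ℚ.+ ½ ℚ.* ε ℚ.≃ ε
ε/2+ε/2≃ε ε =
  ℚ.≃-trans (ℚ.≃-sym (ℚ.*-distribʳ-+ ε ½ ½))
    (ℚ.≃-trans (ℚ.*-congʳ {ε} {½ ℚ.+ ½} {1ℚᵘ} (*≡* refl)) (ℚ.*-identityˡ ε))

interchange : ∀ a b c d →
  (a ℚ.+ b) ℚ.- (c ℚ.+ d) ℚ.≃ (a ℚ.- c) ℚ.+ (b ℚ.- d)
interchange a b c d =
  ℚ.≃-trans (ℚ.≃-reflexive (cong (λ z → (a ℚ.+ b) ℚ.+ z) (ℚ.neg-distrib-+ c d)))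
            (+-interchange a b (ℚ.- c) (ℚ.- d))
  where
  open import Algebra.Properties.CommutativeSemigroup
    (CommutativeMonoid.commutativeSemigroup ℚ.+-0-commutativeMonoid)
    using () renaming (interchange to +-interchange)

infixl 6 _+ℝ_

_+ℝ_ : ℝ → ℝ → ℝ
seq    (x +ℝ y) n = seq x n ℚ.+ seq y n
cauchy (x +ℝ y) ε ε>0
  with cauchy x (½ ℚ.* ε) (ε/2>0 ε ε>0) | cauchy y (½ ℚ.* ε) (ε/2>0 ε ε>0)
... | M , x-close | N , y-close = M ⊔ N , λ m n M⊔N≤m M⊔N≤n → begin
  ∣ (seq x m ℚ.+ seq y m) ℚ.- (seq x n ℚ.+ seq y n) ∣
    ≃⟨ ℚ.∣-∣-cong (interchange (seq x m) (seq y m) (seq x n) (seq y n)) ⟩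
  ∣ (seq x m ℚ.- seq x n) ℚ.+ (seq y m ℚ.- seq y n) ∣
    ≤⟨ ℚ.∣p+q∣≤∣p∣+∣q∣ (seq x m ℚ.- seq x n) (seq y m ℚ.- seq y n) ⟩
  ∣ seq x m ℚ.- seq x n ∣ ℚ.+ ∣ seq y m ℚ.- seq y n ∣
    ≤⟨ ℚ.+-mono-≤
         (x-close m n (ℕ.m⊔n≤o⇒m≤o M N M⊔N≤m) (ℕ.m⊔n≤o⇒m≤o M N M⊔N≤n))
         (y-close m n (ℕ.m⊔n≤o⇒n≤o M N M⊔N≤m) (ℕ.m⊔n≤o⇒n≤o M N M⊔N≤n)) ⟩
  ½ ℚ.* ε ℚ.+ ½ ℚ.* ε
    ≃⟨ ε/2+ε/2≃ε ε ⟩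
  ε ∎
  where open ℚ.≤-Reasoning

0ℝ : ℝ
seq    0ℝ _       = 0ℚᵘ
cauchy 0ℝ ε ε>0 = 0 , λ _ _ _ _ → ℚ.<⇒≤ ε>0

infixr 7 _·_

_·_ : ℕ → ℝ → ℝ
zero  · x = 0ℝ
suc k · x = x +ℝ k · x

sumℝ : List ℝ → ℝ
sumℝ = foldr _+ℝ_ 0ℝ

⌊√_⌋ : ℕ → ℕ
⌊√ zero ⌋  = 0
⌊√ suc a ⌋ with suc ⌊√ a ⌋ ^ 2 ℕ.≤? suc a
... | yes _ = suc ⌊√ a ⌋
... | no  _ = ⌊√ a ⌋

⌊√_⌋-spec : ∀ a → ⌊√ a ⌋ ^ 2 ≤ a × a < suc ⌊√ a ⌋ ^ 2
⌊√ zero ⌋-spec = z≤n , s≤s z≤n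
⌊√ suc a ⌋-spec with suc ⌊√ a ⌋ ^ 2 ℕ.≤? suc a | ⌊√ a ⌋-spec
... | yes p | _ , a<[1+r]² =
  p , ℕ.≤-<-trans a<[1+r]² (ℕ.^-monoˡ-< 2 (ℕ.n<1+n (suc ⌊√ a ⌋)))
... | no ¬p | r²≤a , _     = ℕ.m≤n⇒m≤1+n r²≤a , ℕ.≰⇒> ¬p

√-seq : ℕ → ℕ → ℚᵘ
√-seq a n = mkℚᵘ (+ ⌊√ a * suc n ^ 2 ⌋) n

√-cross : ∀ a m n →
  ⌊√ a * suc m ^ 2 ⌋ * suc n ≤ suc ⌊√ a * suc n ^ 2 ⌋ * suc m
√-cross a m n = ℕ.≮⇒≥ λ lt → ℕ.<-irrefl refl (begin-strict
  (s * M) ^ 2          <⟨ ℕ.^-monoˡ-< 2 lt ⟩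
  (r * N) ^ 2          ≡⟨ [xy]² r N ⟩
  r ^ 2 * N ^ 2        ≤⟨ ℕ.*-monoˡ-≤ (N ^ 2) (proj₁ ⌊√ a * M ^ 2 ⌋-spec) ⟩
  a * M ^ 2 * N ^ 2    ≡⟨ swap a (M ^ 2) (N ^ 2) ⟩
  a * N ^ 2 * M ^ 2    ≤⟨ ℕ.*-monoˡ-≤ (M ^ 2) (ℕ.<⇒≤ (proj₂ ⌊√ a * N ^ 2 ⌋-spec)) ⟩
  s ^ 2 * M ^ 2        ≡⟨ sym ([xy]² s M) ⟩
  (s * M) ^ 2          ∎)
  where
  open ℕ.≤-Reasoning
  M = suc m
  N = suc n
  r = ⌊√ a * M ^ 2 ⌋
  s = suc ⌊√ a * N ^ 2 ⌋
  [xy]² : ∀ x y → (x * y) ^ 2 ≡ x ^ 2 * y ^ 2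
  [xy]² = solve 2 (λ x y → (x :* y) :^ 2 := x :^ 2 :* y :^ 2) refl
    where open ℕSolver.+-*-Solver
  swap : ∀ x y z → x * y * z ≡ x * z * y
  swap = solve 3 (λ x y z → x :* y :* z := x :* z :* y) refl
    where open ℕSolver.+-*-Solver

√-diff : ∀ a m n → √-seq a m ℚ.- √-seq a n ℚ.≤ mkℚᵘ (+ 1) n
√-diff a m n = begin
  √-seq a m ℚ.- √-seq a n
    ≤⟨ ℚ.+-monoˡ-≤ (ℚ.- √-seq a n) x≤y ⟩
  mkℚᵘ (+ suc s) n ℚ.- √-seq a n
    ≃⟨ *≡* (eq (+ s) (+ suc n)) ⟩
  mkℚᵘ (+ 1) n ∎
  where
  open ℚ.≤-Reasoning
  s = ⌊√ a * suc n ^ 2 ⌋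
  cross : + ⌊√ a * suc m ^ 2 ⌋ ℤ.* + suc n ℤ.≤ + suc s ℤ.* + suc m
  cross = subst₂ ℤ._≤_ (ℤ.pos-* ⌊√ a * suc m ^ 2 ⌋ (suc n)) (ℤ.pos-* (suc s) (suc m))
            (ℤ.+≤+ (√-cross a m n))
  x≤y : √-seq a m ℚ.≤ mkℚᵘ (+ suc s) n
  x≤y = *≤* cross
  eq : ∀ s N → ((+ 1 ℤ.+ s) ℤ.* N ℤ.+ ℤ.- s ℤ.* N) ℤ.* N ≡ + 1 ℤ.* (N ℤ.* N)
  eq = solve-∀

1/n≤ε : ∀ p d n → d ≤ n → mkℚᵘ (+ 1) n ℚ.≤ mkℚᵘ +[1+ p ] d
1/n≤ε p d n d≤n = *≤* (subst₂ ℤ._≤_ (ℤ.pos-* 1 (suc d)) (ℤ.pos-* (suc p) (suc n))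
  (ℤ.+≤+ (ℕ.*-mono-≤ {1} {suc p} (s≤s z≤n) (s≤s d≤n))))

neg-diff : ∀ x y → ℚ.- (x ℚ.- y) ℚ.≃ y ℚ.- x
neg-diff (mkℚᵘ x x′) (mkℚᵘ y y′) = *≡* (eq x (+ suc x′) y (+ suc y′))
  where
  eq : ∀ x X y Y → ℤ.- (x ℤ.* Y ℤ.+ ℤ.- y ℤ.* X) ℤ.* (Y ℤ.* X)
                   ≡ (y ℤ.* X ℤ.+ ℤ.- x ℤ.* Y) ℤ.* (X ℤ.* Y)
  eq = solve-∀

∣diff∣≤ : ∀ x y ε → x ℚ.- y ℚ.≤ ε → y ℚ.- x ℚ.≤ ε → ∣ x ℚ.- y ∣ ℚ.≤ ε
∣diff∣≤ x y ε p q with ∣ x ℚ.- y ∣ | ℚ.∣p∣≡p∨∣p∣≡-p (x ℚ.- y)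
... | _ | inj₁ refl = p
... | _ | inj₂ refl = ℚ.≤-trans (ℚ.≤-reflexive (neg-diff x y)) q

infix 8 √_

-- The n-th approximation is ⌊√(a·(n+1)²)⌋ / (n+1), which lies within
-- 1/(n+1) below the square root of a.
√_ : ℕ → ℝ
seq    (√ a) = √-seq a
cauchy (√ a) (mkℚᵘ +[1+ p ] d) _ = d , λ m n d≤m d≤n →
  ∣diff∣≤ (√-seq a m) (√-seq a n) (mkℚᵘ +[1+ p ] d)
    (ℚ.≤-trans (√-diff a m n) (1/n≤ε p d n d≤n))
    (ℚ.≤-trans (√-diff a n m) (1/n≤ε p d m d≤m))
cauchy (√ a) (mkℚᵘ (+ zero)    d) (*<* (ℤ.+<+ ()))
cauchy (√ a) (mkℚᵘ (ℤ.-[1+ p ]) d) (*<* ())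

-- A finite simple graph of order n has vertex set Fin n.
record Graph (n : ℕ) : Set₁ where
  infix 4 _~_ _~?_
  field
    _~_      : Rel (Fin n) 0ℓ
    _~?_     : Decidable _~_
    ~-sym    : Symmetric _~_
    ~-irrefl : Irreflexive _≡_ _~_

module _ {n : ℕ} (G : Graph n) where
  open Graph G

  degree : Fin n → ℕ
  degree v = length (filter (v ~?_) (allFin n))

  -- Each edge uv is listed once, as the pair with u < v.
  edges : List (Fin n × Fin n)
  edges = filter (λ (u , v) → (u Fin.<? v) ×-dec (u ~? v))
                 (cartesianProduct (allFin n) (allFin n))

  SO : ℝ
  SO = sumℝ (map (λ (u , v) → √ (degree u ^ 2 + degree v ^ 2)) edges)

  Connected : Set
  Connected = 1 ≤ n × (∀ u v → Star _~_ u v)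

  -- The cycle v, v₁, …, vᵣ, v through the r + 1 ≥ 3 distinct vertices v ∷ vs.
  IsCycle : Fin n → List (Fin n) → Set
  IsCycle v vs = 2 ≤ length vs × Unique (v ∷ vs) × Linked _~_ (v ∷ vs ++ v ∷ [])

  Acyclic : Set
  Acyclic = ∀ v vs → ¬ IsCycle v vs

  IsTree : Set
  IsTree = Connected × Acyclic

infixl 6 _∖_

_∖_ : ∀ {n} → Graph n → Fin n → Graph (n ∸ 1)
_∖_ {suc n} G u = record
  { _~_      = λ i j → punchIn u i ~ punchIn u j
  ; _~?_     = λ i j → punchIn u i ~? punchIn u j
  ; ~-sym    = ~-sym
  ; ~-irrefl = λ { refl → ~-irrefl refl }
  }
  where open Graph G

IsQuasiTree : ∀ {n} → Graph n → Set
IsQuasiTree G = Connected G × ∃[ u ] IsTree (G ∖ u)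

-- For G : Graph n, G ∈𝒬[ k ] means that G belongs to 𝒬(n,k).
infix 4 _∈𝒬[_]

_∈𝒬[_] : ∀ {n} → Graph n → ℕ → Set
G ∈𝒬[ k ] = IsQuasiTree G × ∃[ u ] (IsTree (G ∖ u) × degree G u ≡ k)

infix 4 _≅_

record _≅_ {m n : ℕ} (G : Graph m) (H : Graph n) : Set where
  field
    bijection : Fin m ↔ Fin n
    adjacency : ∀ u v → Graph._~_ G u v ⇔
                Graph._~_ H (Inverse.to bijection u) (Inverse.to bijection v)

-- S_m, with centre the vertex zero.
star : ∀ m → Graph m
star m = record
  { _~_      = _~_
  ; _~?_     = λ { zero zero → no λ () ; zero (suc _) → yes tt
                 ; (suc _) zero → yes tt ; (suc _) (suc _) → no λ () }
  ; ~-sym    = λ { {zero} {suc _} _ → tt ; {suc _} {zero} _ → tt }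
  ; ~-irrefl = λ { {zero} refl () ; {suc _} refl () }
  }
  where
  _~_ : ∀ {m} → Rel (Fin m) 0ℓ
  zero  ~ zero  = ⊥
  zero  ~ suc _ = ⊤
  suc _ ~ zero  = ⊤
  suc _ ~ suc _ = ⊥

-- The new vertex is zero, and the vertex i of G becomes suc i.
addVertex : ∀ {n} → Graph n → {P : Pred (Fin n) 0ℓ} → U.Decidable P → Graph (suc n)
addVertex {n} G {P} P? = record
  { _~_      = _~′_
  ; _~?_     = λ { zero zero → no λ () ; zero (suc j) → P? j
                 ; (suc i) zero → P? i ; (suc i) (suc j) → i ~? j }
  ; ~-sym    = λ { {zero} {suc _} p → p ; {suc _} {zero} p → p
                 ; {suc _} {suc _} p → ~-sym p }
  ; ~-irrefl = λ { {zero} refl () ; {suc _} refl p → ~-irrefl refl p }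
  }
  where
  open Graph G
  _~′_ : Rel (Fin (suc n)) 0ℓ
  zero  ~′ zero  = ⊥
  zero  ~′ suc j = P j
  suc i ~′ zero  = P i
  suc i ~′ suc j = i ~ j

-- The new vertex is joined to the vertices 0, …, k - 1 of the star, that is,
-- to the centre and k - 1 leaves when 1 ≤ k ≤ n - 1.  The value at n = 0 is
-- a dummy.
Q : ∀ n → ℕ → Graph n
Q zero    k = star zero
Q (suc m) k = addVertex (star m) (λ i → toℕ i ℕ.<? k)

{-# OPTIONS --safe #-}
module Submission where

-- Let T = G - u, of order m = n - 1, and N = N(u).  In G, the degree of a
-- vertex of T is its degree t in T, plus 1 if it lies in N.
--   An edge of T has t + t′ ≤ m since T has no triangle, so it contributes at
-- most √(m² + 1), or √(m² + 4) when both ends lie in N.  Being forests, T and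
-- its subgraph induced by N have at most m - 1 and k - 1 edges.
--   For an edge from u to v ∈ N, convexity of x ↦ √(k² + x²) on [2, m] bounds
-- the contribution by a chord, and Σ (t - 1) ≤ m - 2, the sum being over T;
-- hence these edges contribute at most √(k² + m²) + (k - 1) √(k² + 4).
--   If no vertex of N is adjacent in T to all others, then each edge of T falls
-- short of its bound already in the integers under the root.  If there is such
-- a vertex, T is a star and G ≅ Q n k.
--   The reals never appear in the estimates: the N-th approximation of √ a is
-- ⌊√(a (N+1)²)⌋ / (N+1), so it suffices to compare natural numbers up to an
-- error that does not depend on N, and strictness means a gap linear in N.

open import Defs
open import Data.Bool using (Bool; true; false; if_then_else_; _∧_; not)
import Data.Bool.Properties as Bool
open import Data.Empty using (⊥; ⊥-elim)
open import Data.Fin as Fin using (Fin; zero; suc; toℕ; fromℕ; punchIn; punchOut)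
open import Data.Fin.Permutation using (Permutation; _⟨$⟩ʳ_; lift₀; insert; insert-punchIn) renaming (id to idₚ)
import Data.Fin.Properties as Fin
open import Data.Integer as ℤ using (+[1+_])
import Data.Integer.Properties as ℤ
import Data.Integer.Tactic.RingSolver as ℤSolver
open import Data.List as List using (List; []; _∷_; _++_; length; take; filter; map; cartesianProduct)
open import Data.List.Membership.Propositional using (_∈_)
open import Data.List.Membership.Propositional.Properties using (∈-lookup)
open import Data.List.Properties using (filter-++; map-++)
open import Data.List.Relation.Unary.All as All using ([]; _∷_)
open import Data.List.Relation.Unary.All.Properties using (¬Any⇒All¬)
open import Data.List.Relation.Unary.AllPairs using ([]; _∷_)
open import Data.List.Relation.Unary.Any using (here; there; index)
open import Data.List.Relation.Unary.Linked using (Linked; [-]; _∷_)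
open import Data.List.Relation.Unary.Unique.Propositional using (Unique)
open import Data.List.Relation.Unary.Unique.Propositional.Properties using (take⁺)
open import Data.Nat as ℕ using (ℕ; zero; suc; pred; _+_; _*_; _∸_; _^_; _≤_; _<_; z≤n; s≤s; _≤?_; _<?_)
open import Data.Nat.ListAction using () renaming (sum to listSum)
open import Data.Nat.ListAction.Properties using (sum-++)
open import Data.Nat.Properties
open import Data.Nat.Solver using (module +-*-Solver)
open import Data.Product using (_×_; _,_; proj₁; proj₂; ∃; ∃-syntax)
open import Data.Rational.Unnormalised as ℚ using (mkℚᵘ; 0ℚᵘ; *≤*; *≡*; *<*)
import Data.Rational.Unnormalised.Properties as ℚ
open import Function using (_∘_; const; id; mk⇔; _⇔_; Inverse; Equivalence)
open import Relation.Binary.Construct.Closure.ReflexiveTransitive using (Star; _◅_)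
open import Relation.Binary.Definitions using (tri<; tri≈; tri>)
open import Relation.Binary.PropositionalEquality
  using (_≡_; _≢_; refl; sym; trans; cong; cong₂; subst; subst₂; module ≡-Reasoning)
open import Relation.Nullary using (Dec; does; yes; no; ¬_; contradiction)
open import Relation.Nullary.Decidable using (_×-dec_; ¬?; dec-true; dec-false)
open import Relation.Unary using (Pred; Decidable)

open import Algebra.Properties.Semiring.Sum +-*-semiring
  using (sum; sum-cong-≗; sum-remove; ∑-distrib-+; ∑-comm; ∑-permute; *-distribˡ-sum; *-distribʳ-sum)
open +-*-Solver using (solve; _:+_; _:*_; _:^_; _:=_; con)

-- Integer square roots

*-sq : ∀ x y → (x * y) ^ 2 ≡ x ^ 2 * y ^ 2
*-sq = solve 2 (λ x y → (x :* y) :^ 2 := x :^ 2 :* y :^ 2) refl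

⌊√⌋-greatest : ∀ r a → r ^ 2 ≤ a → r ≤ ⌊√ a ⌋
⌊√⌋-greatest r a r²≤a = ≮⇒≥ λ lt →
  <⇒≱ (proj₂ (⌊√_⌋-spec a)) (≤-trans (^-monoˡ-≤ 2 lt) r²≤a)

sq-cancel-≤ : ∀ x y → x ^ 2 ≤ y ^ 2 → x ≤ y
sq-cancel-≤ x y le = ≮⇒≥ λ lt → <⇒≱ (^-monoˡ-< 2 lt) le

root : ℕ → ℕ → ℕ
root n a = ⌊√ a * suc n ^ 2 ⌋

root-mono : ∀ n {a b} → a ≤ b → root n a ≤ root n b
root-mono n {a} {b} a≤b = ⌊√⌋-greatest (root n a) (b * suc n ^ 2)
  (≤-trans (proj₁ (⌊√_⌋-spec (a * suc n ^ 2))) (*-monoˡ-≤ (suc n ^ 2) a≤b))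

m≤m² : ∀ m → m ≤ m ^ 2
m≤m² zero    = z≤n
m≤m² (suc m) = subst (suc m ≤_) (cong (suc m *_) (sym (*-identityʳ (suc m)))) (m≤m*n (suc m) (suc m))

root-upper : ∀ n a → root n a ≤ a * suc n
root-upper n a = sq-cancel-≤ (root n a) (a * suc n) (begin
  root n a ^ 2        ≤⟨ proj₁ (⌊√_⌋-spec (a * suc n ^ 2)) ⟩
  a * suc n ^ 2       ≤⟨ *-monoˡ-≤ (suc n ^ 2) (m≤m² a) ⟩
  a ^ 2 * suc n ^ 2   ≡⟨ sym (*-sq a (suc n)) ⟩
  (a * suc n) ^ 2     ∎)
  where open ≤-Reasoning

-- Raising r to r + δ adds (2r + δ)δ to the square. As r ≤ a(n + 1) and δ ≤ n + 1, this is at most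
-- (n + 1)(2a + 1)δ, and 2a + 1 ≤ D keeps it within (n + 1)², the room left by b ≥ a + 1. So δ may
-- grow linearly in n.
root-gap : ∀ n δ D {a b} → a < b → 2 * b ≤ D → D * δ ≤ suc n →
           root n a + δ ≤ root n b
root-gap n δ zero    {a} {suc b} _ () _
root-gap n δ D@(suc D′) {a} {b} a<b 2b≤D Dδ≤N =
  ⌊√⌋-greatest (r + δ) (b * N ^ 2) (begin
    (r + δ) ^ 2                       ≡⟨ expand r δ ⟩
    r ^ 2 + (2 * r + δ) * δ           ≤⟨ +-mono-≤ (proj₁ (⌊√_⌋-spec (a * N ^ 2)))
                                          (*-monoˡ-≤ δ (+-mono-≤ (*-monoʳ-≤ 2 (root-upper n a)) δ≤N)) ⟩
    a * N ^ 2 + (2 * (a * N) + N) * δ ≡⟨ regroup a N δ ⟩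
    a * N ^ 2 + N * ((1 + 2 * a) * δ) ≤⟨ +-monoʳ-≤ (a * N ^ 2) (*-monoʳ-≤ N (≤-trans (*-monoˡ-≤ δ 1+2a≤D) Dδ≤N)) ⟩
    a * N ^ 2 + N * N                 ≡⟨ collect a N ⟩
    suc a * N ^ 2                     ≤⟨ *-monoˡ-≤ (N ^ 2) a<b ⟩
    b * N ^ 2                         ∎)
  where
  open ≤-Reasoning
  N = suc n
  r = root n a
  δ≤N : δ ≤ N
  δ≤N = ≤-trans (m≤n*m δ D) Dδ≤N
  1+2a≤D : 1 + 2 * a ≤ D
  1+2a≤D = ≤-trans (*-monoʳ-< 2 a<b) 2b≤D
  expand : ∀ r δ → (r + δ) ^ 2 ≡ r ^ 2 + (2 * r + δ) * δ
  expand = solve 2 (λ r δ → (r :+ δ) :^ 2 := r :^ 2 :+ (con 2 :* r :+ δ) :* δ) refl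
  regroup : ∀ a N δ → a * N ^ 2 + (2 * (a * N) + N) * δ ≡ a * N ^ 2 + N * ((1 + 2 * a) * δ)
  regroup = solve 3 (λ a N δ → a :* N :^ 2 :+ (con 2 :* (a :* N) :+ N) :* δ
    := a :* N :^ 2 :+ N :* ((con 1 :+ con 2 :* a) :* δ)) refl
  collect : ∀ a N → a * N ^ 2 + N * N ≡ suc a * N ^ 2
  collect = solve 2 (λ a N → a :* N :^ 2 :+ N :* N := (con 1 :+ a) :* N :^ 2) refl

-- (x + y)(k, 2 + x) = x (k, 2 + x + y) + y (k, 2), so this is the triangle
-- inequality for the Euclidean norm, up to the rounding of the roots.
root-chord : ∀ n k {x y M} → x + y ≡ M →
  M * root n (k ^ 2 + (2 + x) ^ 2) ≤ x * root n (k ^ 2 + (2 + M) ^ 2) + y * root n (k ^ 2 + 4) + M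
root-chord n k {x} {y} refl = begin
  (x + y) * r     ≤⟨ sq-cancel-≤ ((x + y) * r) (x * p + y * q) squares ⟩
  x * p + y * q   ≡⟨ unfold x (root n P) y (root n Q₂) ⟩
  x * root n P + y * root n Q₂ + (x + y) ∎
  where
  open ≤-Reasoning
  N = suc n
  P = k ^ 2 + (2 + (x + y)) ^ 2
  Q₂ = k ^ 2 + 4
  Z = k ^ 2 + (2 + x) ^ 2
  -- The inner product of (k, 2 + x + y) and (k, 2).
  S = k ^ 2 + 2 * (2 + (x + y))
  r = root n Z
  -- `p` and `q` are rounded up, so that their squares dominate `P * N ^ 2` and `Q₂ * N ^ 2`; the
  -- added units make up the error M.
  p = suc (root n P)
  q = suc (root n Q₂)
  unfold : ∀ x p y q → x * suc p + y * suc q ≡ x * p + y * q + (x + y)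
  unfold = solve 4 (λ x p y q → x :* (con 1 :+ p) :+ y :* (con 1 :+ q) := x :* p :+ y :* q :+ (x :+ y)) refl
  PN² : P * N ^ 2 ≤ p ^ 2
  PN² = <⇒≤ (proj₂ (⌊√_⌋-spec (P * N ^ 2)))
  QN² : Q₂ * N ^ 2 ≤ q ^ 2
  QN² = <⇒≤ (proj₂ (⌊√_⌋-spec (Q₂ * N ^ 2)))
  -- Lagrange's identity for the vectors (k, 2 + M) and (k, 2), whose determinant is k M up to sign;
  -- dropping that square gives Cauchy-Schwarz in `SN²`.
  lagrange : ∀ k M N → ((k ^ 2 + 2 * (2 + M)) * N ^ 2) ^ 2 + (k * M * N ^ 2) ^ 2
                     ≡ ((k ^ 2 + (2 + M) ^ 2) * N ^ 2) * ((k ^ 2 + 4) * N ^ 2)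
  lagrange = solve 3 (λ k M N →
    ((k :^ 2 :+ con 2 :* (con 2 :+ M)) :* N :^ 2) :^ 2 :+ (k :* M :* N :^ 2) :^ 2
    := ((k :^ 2 :+ (con 2 :+ M) :^ 2) :* N :^ 2) :* ((k :^ 2 :+ con 4) :* N :^ 2)) refl
  SN² : S * N ^ 2 ≤ p * q
  SN² = sq-cancel-≤ (S * N ^ 2) (p * q) (begin
    (S * N ^ 2) ^ 2                                   ≤⟨ m≤m+n _ _ ⟩
    (S * N ^ 2) ^ 2 + (k * (x + y) * N ^ 2) ^ 2       ≡⟨ lagrange k (x + y) N ⟩
    (P * N ^ 2) * (Q₂ * N ^ 2)                        ≤⟨ *-mono-≤ PN² QN² ⟩
    p ^ 2 * q ^ 2                                     ≡⟨ sym (*-sq p q) ⟩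
    (p * q) ^ 2                                       ∎)
  decompose : ∀ k x y N →
    (x + y) ^ 2 * ((k ^ 2 + (2 + x) ^ 2) * N ^ 2)
      ≡ x ^ 2 * ((k ^ 2 + (2 + (x + y)) ^ 2) * N ^ 2) + y ^ 2 * ((k ^ 2 + 4) * N ^ 2)
        + 2 * x * y * ((k ^ 2 + 2 * (2 + (x + y))) * N ^ 2)
  decompose = solve 4 (λ k x y N →
    (x :+ y) :^ 2 :* ((k :^ 2 :+ (con 2 :+ x) :^ 2) :* N :^ 2)
    := x :^ 2 :* ((k :^ 2 :+ (con 2 :+ (x :+ y)) :^ 2) :* N :^ 2)
      :+ y :^ 2 :* ((k :^ 2 :+ con 4) :* N :^ 2)
      :+ con 2 :* x :* y :* ((k :^ 2 :+ con 2 :* (con 2 :+ (x :+ y))) :* N :^ 2)) refl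
  complete : ∀ x p y q → x ^ 2 * p ^ 2 + y ^ 2 * q ^ 2 + 2 * x * y * (p * q) ≡ (x * p + y * q) ^ 2
  complete = solve 4 (λ x p y q →
    x :^ 2 :* p :^ 2 :+ y :^ 2 :* q :^ 2 :+ con 2 :* x :* y :* (p :* q)
    := (x :* p :+ y :* q) :^ 2) refl
  squares : ((x + y) * r) ^ 2 ≤ (x * p + y * q) ^ 2
  squares = begin
    ((x + y) * r) ^ 2             ≡⟨ *-sq (x + y) r ⟩
    (x + y) ^ 2 * r ^ 2           ≤⟨ *-monoʳ-≤ ((x + y) ^ 2) (proj₁ (⌊√_⌋-spec (Z * N ^ 2))) ⟩
    (x + y) ^ 2 * (Z * N ^ 2)     ≡⟨ decompose k x y N ⟩
    x ^ 2 * (P * N ^ 2) + y ^ 2 * (Q₂ * N ^ 2) + 2 * x * y * (S * N ^ 2)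
      ≤⟨ +-mono-≤ (+-mono-≤ (*-monoʳ-≤ (x ^ 2) PN²) (*-monoʳ-≤ (y ^ 2) QN²)) (*-monoʳ-≤ (2 * x * y) SN²) ⟩
    x ^ 2 * p ^ 2 + y ^ 2 * q ^ 2 + 2 * x * y * (p * q) ≡⟨ complete x p y q ⟩
    (x * p + y * q) ^ 2           ∎

-- Finite sums and forests

-- The precedence lies between those of `*` and `+`: a summand may be a product, but the sum stops
-- at an addition.
infix 6.5 sumOver

sumOver : ∀ n → (Fin n → ℕ) → ℕ
sumOver _ = sum

syntax sumOver n (λ i → x) = ∑[ i < n ] x

sum-mono : ∀ {n} {f g : Fin n → ℕ} → (∀ i → f i ≤ g i) → sum f ≤ sum g
sum-mono {zero}  le = z≤n
sum-mono {suc n} le = +-mono-≤ (le zero) (sum-mono (le ∘ suc))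

sum-const : ∀ n c → ∑[ i < n ] c ≡ n * c
sum-const zero    c = refl
sum-const (suc n) c = cong (c +_) (sum-const n c)

sum-ones : ∀ n → ∑[ i < n ] 1 ≡ n
sum-ones n = trans (sum-const n 1) (*-identityʳ n)

sum-zero : ∀ {n} {f : Fin n → ℕ} → (∀ i → f i ≡ 0) → sum f ≡ 0
sum-zero {n} f≡0 = trans (sum-cong-≗ f≡0) (trans (sum-const n 0) (*-zeroʳ n))

term≤sum : ∀ {n} (f : Fin n → ℕ) i → f i ≤ sum f
term≤sum f zero    = m≤m+n _ _
term≤sum f (suc i) = ≤-trans (term≤sum (f ∘ suc) i) (m≤n+m _ _)

χ : Bool → ℕ
χ b = if b then 1 else 0

χ≤1 : ∀ b → χ b ≤ 1
χ≤1 true  = ≤-refl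
χ≤1 false = z≤n

∑χ≤ : ∀ {l} (b : Fin l → Bool) → ∑[ i < l ] χ (b i) ≤ l
∑χ≤ {l} b = ≤-trans (sum-mono (χ≤1 ∘ b)) (≤-reflexive (sum-ones l))

χ-*-≤ : ∀ b x → χ b * x ≤ x
χ-*-≤ true  x = ≤-reflexive (*-identityˡ x)
χ-*-≤ false x = z≤n

χ-*-mono : ∀ b {x y} → (b ≡ true → x ≤ y) → χ b * x ≤ χ b * y
χ-*-mono true  le = *-monoʳ-≤ 1 (le refl)
χ-*-mono false le = z≤n

χ-*-cong : ∀ b {x y} → (b ≡ true → x ≡ y) → χ b * x ≡ χ b * y
χ-*-cong true  eq = cong (1 *_) (eq refl)
χ-*-cong false eq = refl

witness : ∀ {a} {A : Set a} (a? : Dec A) → does a? ≡ true → A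
witness (yes a) refl = a

sum-indicator : ∀ {n} (l : Fin n) c → ∑[ j < n ] χ (does (j Fin.≟ l)) * c ≡ c
sum-indicator {suc n} zero    c = trans (cong₂ _+_ (*-identityˡ c) (sum-zero {n} (λ _ → refl))) (+-identityʳ c)
sum-indicator {suc n} (suc l) c = sum-indicator l c

infixl 6 _−_

_−_ : ∀ {n} → (Fin n → Bool) → Fin n → (Fin n → Bool)
(s − l) j = s j ∧ not (does (j Fin.≟ l))

-- Since l belongs to s, the indicator of s is that of l plus that of `s − l`.
sum-delete : ∀ {n} (s : Fin n → Bool) l → s l ≡ true → (f : Fin n → ℕ) →
  ∑[ j < n ] χ (s j) * f j ≡ f l + ∑[ j < n ] χ ((s − l) j) * f j
sum-delete {n} s l sl f = begin
  ∑[ j < n ] χ (s j) * f j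
    ≡⟨ sum-cong-≗ split ⟩
  ∑[ j < n ] (χ (does (j Fin.≟ l)) * f l + χ ((s − l) j) * f j)
    ≡⟨ ∑-distrib-+ (λ j → χ (does (j Fin.≟ l)) * f l) _ ⟩
  ∑[ j < n ] χ (does (j Fin.≟ l)) * f l + ∑[ j < n ] χ ((s − l) j) * f j
    ≡⟨ cong (_+ (∑[ j < n ] χ ((s − l) j) * f j)) (sum-indicator l (f l)) ⟩
  f l + ∑[ j < n ] χ ((s − l) j) * f j ∎
  where
  open ≡-Reasoning
  split : ∀ j → χ (s j) * f j ≡ χ (does (j Fin.≟ l)) * f l + χ ((s − l) j) * f j
  split j with j Fin.≟ l | s j in eq
  ... | yes refl | true  = sym (+-identityʳ (1 * f l))
  ... | yes refl | false with () ← trans (sym eq) sl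
  ... | no _     | true  = refl
  ... | no _     | false = refl

-- Adjacency, degrees and cycles

adj : ∀ {n} → Graph n → Fin n → Fin n → ℕ
adj G i j = χ (does (Graph._~?_ G i j))

-- Stated for an arbitrary tabulated list, because the tail of `allFin` is not of the form `allFin`.
length-filter-tabulate : ∀ {a p} {A : Set a} {P : Pred A p} (P? : Decidable P) {n} (f : Fin n → A) →
  length (filter P? (List.tabulate f)) ≡ ∑[ i < n ] χ (does (P? (f i)))
length-filter-tabulate P? {zero}  f = refl
length-filter-tabulate P? {suc n} f with does (P? (f zero))
... | true  = cong suc (length-filter-tabulate P? (f ∘ suc))
... | false = length-filter-tabulate P? (f ∘ suc)

degree-sum : ∀ {n} (G : Graph n) v → degree G v ≡ ∑[ j < n ] adj G v j
degree-sum G v = length-filter-tabulate (Graph._~?_ G v) id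

Unique⇒lookup-injective : ∀ {a} {A : Set a} {xs : List A} → Unique xs →
  ∀ i j → List.lookup xs i ≡ List.lookup xs j → i ≡ j
Unique⇒lookup-injective (_ ∷ _) zero    zero    _  = refl
Unique⇒lookup-injective {xs = _ ∷ xs} (x∉ ∷ _) zero (suc j) eq = contradiction eq (All.lookup x∉ (∈-lookup j))
Unique⇒lookup-injective {xs = _ ∷ xs} (x∉ ∷ _) (suc i) zero eq = contradiction (sym eq) (All.lookup x∉ (∈-lookup i))
Unique⇒lookup-injective (_ ∷ u) (suc i) (suc j) eq = cong suc (Unique⇒lookup-injective u i j eq)

-- Pigeonhole: positions inject into vertices.
Unique⇒length≤ : ∀ {n} {xs : List (Fin n)} → Unique xs → length xs ≤ n
Unique⇒length≤ u = Fin.injective⇒≤ (Unique⇒lookup-injective u _ _)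

module _ {n} (G : Graph n) where
  open Graph G

  does-sym : ∀ i j → does (i ~? j) ≡ does (j ~? i)
  does-sym i j with i ~? j | j ~? i
  ... | yes _ | yes _ = refl
  ... | no  _ | no  _ = refl
  ... | yes p | no ¬p = contradiction (~-sym p) ¬p
  ... | no ¬p | yes p = contradiction (~-sym p) ¬p

  adj-sym : ∀ i j → adj G i j ≡ adj G j i
  adj-sym i j = cong χ (does-sym i j)

  adj-irrefl : ∀ i → adj G i i ≡ 0
  adj-irrefl i = cong χ (dec-false (i ~? i) (~-irrefl refl))

  adj-yes : ∀ {i j} → i ~ j → adj G i j ≡ 1
  adj-yes {i} {j} p = cong χ (dec-true (i ~? j) p)

  -- The prefix of `ws` taken here ends at x itself, so the edge x ~ v can follow it.
  close : ∀ {v x} a ws (x∈ws : x ∈ ws) → Linked _~_ (a ∷ ws) → x ~ v →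
    Linked _~_ (a ∷ take (suc (toℕ (index x∈ws))) ws ++ v ∷ [])
  close a (_ ∷ _) (here refl) (a~x ∷ _) x~v = a~x ∷ x~v ∷ [-]
  close a (b ∷ ws) (there x∈ws) (a~b ∷ path) x~v = a~b ∷ close b ws x∈ws path x~v

  -- The path is cut after x and closed by the edge back to v. Since p comes between v and x, at
  -- least three vertices remain.
  cycle : ∀ {v x} p ws → x ∈ ws → Linked _~_ (v ∷ p ∷ ws) → Unique (v ∷ p ∷ ws) → x ~ v →
    ∃[ vs ] IsCycle G v vs
  cycle {v} p ws@(_ ∷ _) x∈ws (v~p ∷ path) uniq x~v =
    p ∷ take (suc (toℕ (index x∈ws))) ws ,
    s≤s (s≤s z≤n) ,
    take⁺ (suc (suc (suc (toℕ (index x∈ws))))) uniq ,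
    v~p ∷ close p ws x∈ws path x~v

module Forest {n} (G : Graph n) (acyclic : Acyclic G) where
  open Graph G
  open import Data.List.Membership.DecPropositional (Fin._≟_ {n}) using (_∈?_)

  no-triangle : ∀ {x y z} → x ~ y → y ~ z → z ~ x → ⊥
  no-triangle {x} {y} {z} x~y y~z z~x = acyclic x (y ∷ z ∷ [])
    ( s≤s (s≤s z≤n)
    , ((λ eq → ~-irrefl eq x~y) ∷ (λ eq → ~-irrefl (sym eq) z~x) ∷ [])
      ∷ ((λ eq → ~-irrefl eq y~z) ∷ []) ∷ [] ∷ []
    , x~y ∷ y~z ∷ z~x ∷ [-])

  -- The edges of the subgraph induced by s are counted twice.
  ∣E∣ : (Fin n → Bool) → ℕ
  ∣E∣ s = ∑[ i < n ] χ (s i) * (∑[ j < n ] χ (s j) * adj G i j)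

  -- Minimum degree at least 2 in the subgraph induced by s, in the form used to prolong a path: w
  -- is the vertex to avoid.
  Branching : (Fin n → Bool) → Set
  Branching s = ∀ v w → s v ≡ true → ∃[ x ] (s x ≡ true × v ~ x × x ≢ w)

  -- The path grows at its head v, by a neighbour x other than the previous vertex. If x already
  -- lies on the path, a cycle closes, which is excluded.
  long-path : ∀ s → Branching s → ∀ v₀ → s v₀ ≡ true → ∀ k →
    ∃[ v ] ∃[ vs ] (length vs ≡ k × s v ≡ true × Unique (v ∷ vs) × Linked _~_ (v ∷ vs))
  long-path s br v₀ sv₀ zero = v₀ , [] , refl , sv₀ , [] ∷ [] , [-]
  long-path s br v₀ sv₀ (suc k) with long-path s br v₀ sv₀ k
  ... | v , [] , len , sv , uniq , path =
    -- There is no previous vertex yet; v itself serves as a dummy.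
    let x , sx , v~x , _ = br v v sv in
    x , v ∷ [] , cong suc len , sx , ((λ eq → ~-irrefl (sym eq) v~x) ∷ []) ∷ uniq , ~-sym v~x ∷ path
  ... | v , p ∷ ws , len , sv , uniq , path with br v p sv
  ...   | x , sx , v~x , x≢p with x ∈? ws
  ...     | yes x∈ws = let vs , c = cycle G p ws x∈ws path uniq (~-sym v~x) in ⊥-elim (acyclic v vs c)
  ...     | no  x∉ws = x , v ∷ p ∷ ws , cong suc len , sx ,
    ((λ eq → ~-irrefl (sym eq) v~x) ∷ x≢p ∷ ¬Any⇒All¬ ws x∉ws) ∷ uniq , ~-sym v~x ∷ path

  -- Otherwise there would be a path with n + 1 distinct vertices.
  ¬branching : ∀ s → Branching s → ∀ v₀ → s v₀ ≡ true → ⊥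
  ¬branching s br v₀ sv₀ =
    let v , vs , len , _ , uniq , _ = long-path s br v₀ sv₀ n in
    <-irrefl refl (subst (_< n) len (Unique⇒length≤ uniq))

  -- Membership and adjacency are decidable, so a failed search for a leaf makes s branching: a
  -- vertex with no neighbour in s besides w has degree at most 1 there.
  leaf : ∀ s v₀ → s v₀ ≡ true → ∃[ l ] (s l ≡ true × ∑[ j < n ] χ (s j) * adj G l j ≤ 1)
  leaf s v₀ sv₀ with Fin.any? (λ l → (s l Bool.≟ true) ×-dec (∑[ j < n ] χ (s j) * adj G l j ≤? 1))
  ... | yes found = found
  ... | no ¬leaf = ⊥-elim (¬branching s branching v₀ sv₀)
    where
    branching : Branching s
    branching v w sv with Fin.any? (λ x → (s x Bool.≟ true) ×-dec ((v ~? x) ×-dec ¬? (x Fin.≟ w)))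
    ... | yes found = found
    ... | no ¬next = contradiction (v , sv , few) ¬leaf
      where
      only-w : ∀ j → χ (s j) * adj G v j ≤ χ (does (j Fin.≟ w)) * 1
      only-w j with s j in sj | v ~? j | j Fin.≟ w
      ... | false | _     | _     = z≤n
      ... | true  | no _  | _     = z≤n
      ... | true  | yes _ | yes _ = ≤-refl
      ... | true  | yes v~j | no j≢w = contradiction (j , sj , v~j , j≢w) ¬next
      few : ∑[ j < n ] χ (s j) * adj G v j ≤ 1
      few = ≤-trans (sum-mono only-w) (≤-reflexive (sum-indicator w 1))

  nonempty : ∀ (s : Fin n → Bool) {c} → ∑[ i < n ] χ (s i) ≡ suc c → ∃[ v ] (s v ≡ true)
  nonempty s size with Fin.any? (λ v → s v Bool.≟ true)
  ... | yes found = found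
  ... | no ¬found with () ← trans (sym size) (sum-zero λ i → cong χ (Bool.¬-not λ si → ¬found (i , si)))

  -- Induction on the size: deleting a leaf l removes at most one edge, that is, two ordered pairs,
  -- one from the row and one from the column of l.
  forest : ∀ c (s : Fin n → Bool) → ∑[ i < n ] χ (s i) ≡ c → ∣E∣ s ≤ 2 * (c ∸ 1)
  forest zero s size = ≤-reflexive (sum-zero λ i →
    cong (_* (∑[ j < n ] χ (s j) * adj G i j)) (n≤0⇒n≡0 (subst (χ (s i) ≤_) size (term≤sum (χ ∘ s) i))))
  forest (suc c) s size with nonempty s size
  ... | v₀ , sv₀ with leaf s v₀ sv₀
  ...   | l , sl , few = begin
    ∣E∣ s
      ≡⟨ sum-delete s l sl _ ⟩
    F l + ∑[ i < n ] χ (s′ i) * F i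
      ≡⟨ cong₂ _+_ F≡F′ (sum-cong-≗ λ i → trans (cong (χ (s′ i) *_) (sum-delete s l sl (adj G i)))
                                             (*-distribˡ-+ (χ (s′ i)) (adj G i l) (F′ i))) ⟩
    F′ l + ∑[ i < n ] (χ (s′ i) * adj G i l + χ (s′ i) * F′ i)
      ≡⟨ cong (F′ l +_) (trans (∑-distrib-+ (λ i → χ (s′ i) * adj G i l) _)
           (cong (_+ ∣E∣ s′) (sum-cong-≗ λ i → cong (χ (s′ i) *_) (adj-sym G i l)))) ⟩
    F′ l + (F′ l + ∣E∣ s′)
      ≤⟨ bound c size′ ⟩
    2 * c ∎
    where
    open ≤-Reasoning
    s′ = s − l
    F F′ : Fin n → ℕ
    F  i = ∑[ j < n ] χ (s j) * adj G i j
    F′ i = ∑[ j < n ] χ (s′ j) * adj G i j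
    F≡F′ : F l ≡ F′ l
    F≡F′ = trans (sum-delete s l sl (adj G l)) (cong (_+ F′ l) (adj-irrefl G l))
    size′ : ∑[ i < n ] χ (s′ i) ≡ c
    size′ = suc-injective (sym (trans (sym size) (trans
      (sum-cong-≗ λ i → sym (*-identityʳ (χ (s i)))) (trans (sum-delete s l sl (λ _ → 1))
      (cong suc (sum-cong-≗ λ i → *-identityʳ (χ (s′ i))))))))
    F′≤1 : F′ l ≤ 1
    F′≤1 = subst (_≤ 1) F≡F′ few
    F′≤size : F′ l ≤ ∑[ i < n ] χ (s′ i)
    F′≤size = sum-mono λ j → subst (_≤ χ (s′ j)) (*-comm (adj G l j) (χ (s′ j))) (χ-*-≤ (does (l ~? j)) (χ (s′ j)))
    -- The subtraction in `c ∸ 1` truncates at 0, so the last vertex must remove no edge at all: its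
    -- degree is bounded by the size of the empty `s′`. In the other case degree at most 1 suffices.
    bound : ∀ c → ∑[ i < n ] χ (s′ i) ≡ c → F′ l + (F′ l + ∣E∣ s′) ≤ 2 * c
    bound zero    eq = +-mono-≤ F′≤0 (+-mono-≤ F′≤0 (forest zero s′ eq))
      where F′≤0 = subst (F′ l ≤_) eq F′≤size
    bound (suc c) eq = ≤-trans (+-mono-≤ F′≤1 (+-mono-≤ F′≤1 (forest (suc c) s′ eq)))
      (≤-reflexive (sym (*-suc 2 c)))

-- Reals as sequences of natural numbers

-- The n-th approximation of x is f n / (n + 1).
infix 4 _≐_
record _≐_ (x : ℝ) (f : ℕ → ℕ) : Set where
  constructor approx
  field at : ∀ n → seq x n ℚ.≃ mkℚᵘ (ℤ.+ f n) n
open _≐_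

same-denominator : ∀ a b n → mkℚᵘ (ℤ.+ a) n ℚ.+ mkℚᵘ (ℤ.+ b) n ℚ.≃ mkℚᵘ (ℤ.+ (a + b)) n
same-denominator a b n = *≡* (eq (ℤ.+ a) (ℤ.+ b) (ℤ.+ suc n))
  where
  eq : ∀ a b N → (a ℤ.* N ℤ.+ b ℤ.* N) ℤ.* N ≡ (a ℤ.+ b) ℤ.* (N ℤ.* N)
  eq = ℤSolver.solve-∀

0ℝ-≐ : 0ℝ ≐ λ _ → 0
0ℝ-≐ = approx λ n → *≡* refl

+ℝ-≐ : ∀ {x y f g} → x ≐ f → y ≐ g → x +ℝ y ≐ λ n → f n + g n
+ℝ-≐ {f = f} {g} x≐f y≐g = approx λ n → ℚ.≃-trans (ℚ.+-cong (at x≐f n) (at y≐g n)) (same-denominator (f n) (g n) n)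

·-≐ : ∀ k {x f} → x ≐ f → k · x ≐ λ n → k * f n
·-≐ zero    x≐f = 0ℝ-≐
·-≐ (suc k) x≐f = +ℝ-≐ x≐f (·-≐ k x≐f)

√-≐ : ∀ a → √ a ≐ λ n → root n a
√-≐ a = approx λ n → ℚ.≃-refl

sumℝ-≐ : ∀ {A : Set} (w : A → ℕ) xs → sumℝ (map (λ x → √ (w x)) xs) ≐ λ n → listSum (map (λ x → root n (w x)) xs)
sumℝ-≐ w []       = 0ℝ-≐
sumℝ-≐ w (x ∷ xs) = +ℝ-≐ (√-≐ (w x)) (sumℝ-≐ w xs)

≐-cong : ∀ {x f g} → x ≐ f → (∀ n → f n ≡ g n) → x ≐ g
≐-cong {x} x≐f f≡g = approx λ n → subst (λ a → seq x n ℚ.≃ mkℚᵘ (ℤ.+ a) n) (f≡g n) (at x≐f n)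

combination-≐ : ∀ c k w x y z →
  c · √ w +ℝ k · (√ x +ℝ √ y) +ℝ √ z ≐ λ N → c * root N w + k * (root N x + root N y) + root N z
combination-≐ c k w x y z =
  +ℝ-≐ (+ℝ-≐ (·-≐ c (√-≐ w)) (·-≐ k (+ℝ-≐ (√-≐ x) (√-≐ y)))) (√-≐ z)

mkℚᵘ-mono : ∀ {a b} n → a ≤ b → mkℚᵘ (ℤ.+ a) n ℚ.≤ mkℚᵘ (ℤ.+ b) n
mkℚᵘ-mono {a} {b} n a≤b = *≤* (ℤ.*-monoʳ-≤-nonNeg (ℤ.+ suc n) (ℤ.+≤+ a≤b))

mkℚᵘ-cancel : ∀ {a b} n → mkℚᵘ (ℤ.+ a) n ℚ.≤ mkℚᵘ (ℤ.+ b) n → a ≤ b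
mkℚᵘ-cancel {a} {b} n (*≤* le) = ℤ.drop‿+≤+ (ℤ.*-cancelʳ-≤-pos (ℤ.+ a) (ℤ.+ b) (ℤ.+ suc n) le)

-- After division the error is C/(n + 1), which is below ε = (1 + p)/(1 + d) once n ≥ C(1 + d).
≐⇒≤ℝ : ∀ {x y f g} C → x ≐ f → y ≐ g → (∀ n → f n ≤ g n + C) → x ≤ℝ y
≐⇒≤ℝ {x} {y} {f} {g} C x≐f y≐g le (mkℚᵘ +[1+ p ] d) _ = C * suc d , λ n N≤n → begin
  seq x n                             ≃⟨ at x≐f n ⟩
  mkℚᵘ (ℤ.+ f n) n                      ≤⟨ mkℚᵘ-mono n (le n) ⟩
  mkℚᵘ (ℤ.+ (g n + C)) n                ≃⟨ same-denominator (g n) C n ⟨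
  mkℚᵘ (ℤ.+ g n) n ℚ.+ mkℚᵘ (ℤ.+ C) n     ≤⟨ ℚ.+-mono-≤ (ℚ.≤-reflexive (ℚ.≃-sym (at y≐g n))) (small n N≤n) ⟩
  seq y n ℚ.+ mkℚᵘ +[1+ p ] d         ∎
  where
  open ℚ.≤-Reasoning
  small : ∀ n → C * suc d ≤ n → mkℚᵘ (ℤ.+ C) n ℚ.≤ mkℚᵘ +[1+ p ] d
  small n N≤n = *≤* (subst₂ ℤ._≤_ (ℤ.pos-* C (suc d)) (ℤ.pos-* (suc p) (suc n))
    (ℤ.+≤+ (≤-trans N≤n (≤-trans (n≤1+n n) (m≤n*m (suc n) (suc p))))))
≐⇒≤ℝ C _ _ _ (mkℚᵘ (ℤ.+ zero) d) (*<* (ℤ.+<+ ()))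
≐⇒≤ℝ C _ _ _ (mkℚᵘ (ℤ.-[1+ p ]) d) (*<* ())

≐⇒≈ℝ : ∀ {x y f g} → x ≐ f → y ≐ g → (∀ n → f n ≡ g n) → x ≈ℝ y
≐⇒≈ℝ {x} {y} {f} {g} x≐f y≐g f≡g ε ε>0 = 0 , λ n _ → begin
  ℚ.∣ seq x n ℚ.- seq y n ∣  ≃⟨ ℚ.∣-∣-cong (ℚ.+-congʳ (seq x n) (ℚ.-‿cong (ℚ.≃-sym (x≃y n)))) ⟩
  ℚ.∣ seq x n ℚ.- seq x n ∣  ≃⟨ ℚ.∣-∣-cong (ℚ.+-inverseʳ (seq x n)) ⟩
  ℚ.∣ 0ℚᵘ ∣                  ≤⟨ ℚ.<⇒≤ ε>0 ⟩
  ε                          ∎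
  where
  open ℚ.≤-Reasoning
  x≃y : ∀ n → seq x n ℚ.≃ seq y n
  x≃y n = ℚ.≃-trans (at x≐f n) (ℚ.≃-trans (ℚ.≃-reflexive (cong (λ a → mkℚᵘ (ℤ.+ a) n) (f≡g n))) (ℚ.≃-sym (at y≐g n)))

p≤∣p∣ : ∀ p → p ℚ.≤ ℚ.∣ p ∣
p≤∣p∣ (mkℚᵘ (ℤ.+ _) _)      = ℚ.≤-refl
p≤∣p∣ (mkℚᵘ ℤ.-[1+ _ ] _) = *≤* ℤ.-≤+

≈ℝ⇒≤ : ∀ {x y} → x ≈ℝ y → y ≤ℝ x
≈ℝ⇒≤ {x} {y} x≈y ε ε>0 with x≈y ε ε>0
... | N , close = N , λ n N≤n → begin
  seq y n                             ≃⟨ ℚ.≃-sym (cancel (seq x n) (seq y n)) ⟩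
  seq x n ℚ.+ (seq y n ℚ.- seq x n)   ≤⟨ ℚ.+-monoʳ-≤ (seq x n) (p≤∣p∣ (seq y n ℚ.- seq x n)) ⟩
  seq x n ℚ.+ ℚ.∣ seq y n ℚ.- seq x n ∣ 
    ≃⟨ ℚ.+-congʳ (seq x n) (ℚ.≃-trans (ℚ.∣-∣-cong (ℚ.≃-sym (neg-diff (seq x n) (seq y n))))
                                      (ℚ.≃-reflexive (ℚ.∣-p∣≡∣p∣ (seq x n ℚ.- seq y n)))) ⟩
  seq x n ℚ.+ ℚ.∣ seq x n ℚ.- seq y n ∣ ≤⟨ ℚ.+-monoʳ-≤ (seq x n) (close n N≤n) ⟩
  seq x n ℚ.+ ε                       ∎
  where
  open ℚ.≤-Reasoning
  cancel : ∀ p q → p ℚ.+ (q ℚ.- p) ℚ.≃ q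
  cancel (mkℚᵘ a b) (mkℚᵘ c d) = *≡* (eq a (ℤ.+ suc b) c (ℤ.+ suc d))
    where
    eq : ∀ a B c D → (a ℤ.* (D ℤ.* B) ℤ.+ (c ℤ.* B ℤ.+ ℤ.- a ℤ.* D) ℤ.* B) ℤ.* D ≡ c ℤ.* (B ℤ.* (D ℤ.* B))
    eq = ℤSolver.solve-∀

-- The hypothesis says that x ≤ y - 1/(D + 1).
≐⇒¬≈ℝ : ∀ {x y f g} C D → x ≐ f → y ≐ g →
  (∀ n δ → suc D * δ ≤ suc n → f n + δ ≤ g n + C) → ¬ x ≈ℝ y
≐⇒¬≈ℝ {x} {y} {f} {g} C D x≐f y≐g gap x≈y
  -- The tolerance is 1/(2(D + 1)), half the gap. Denominators are stored less one, hence `pred`.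
  with ≈ℝ⇒≤ {x} {y} x≈y (mkℚᵘ (ℤ.+ 1) (pred (2 * suc D))) (*<* (ℤ.+<+ (s≤s z≤n)))
... | N₀ , close = <⇒≱ (s≤s (m≤m+n C N₀)) M≤C
  where
  E = pred (2 * suc D)
  -- Choosing n + 1 = 2(D + 1)M turns the tolerance into exactly M/(n + 1) and admits δ = 2M in
  -- `gap`, which forces M ≤ C. The choice of M contradicts this and ensures n ≥ N₀.
  M = suc (C + N₀)
  n = pred (suc E * M)
  N₀≤n : N₀ ≤ n
  N₀≤n = ≤-pred (≤-trans (s≤s (m≤n+m N₀ C)) (m≤n*m M (suc E)))
  ε≃M/n : mkℚᵘ (ℤ.+ 1) E ℚ.≃ mkℚᵘ (ℤ.+ M) n
  ε≃M/n = *≡* (trans (sym (ℤ.pos-* 1 (suc n))) (trans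
    (cong ℤ.+_ (trans (*-identityˡ (suc n)) (*-comm (suc E) M)))
    (ℤ.pos-* M (suc E))))
  g≤f+M : g n ≤ f n + M
  g≤f+M = mkℚᵘ-cancel n (begin
    mkℚᵘ (ℤ.+ g n) n                    ≃⟨ ℚ.≃-sym (at y≐g n) ⟩
    seq y n                           ≤⟨ close n N₀≤n ⟩
    seq x n ℚ.+ mkℚᵘ (ℤ.+ 1) E          ≃⟨ ℚ.+-cong (at x≐f n) ε≃M/n ⟩
    mkℚᵘ (ℤ.+ f n) n ℚ.+ mkℚᵘ (ℤ.+ M) n   ≃⟨ same-denominator (f n) M n ⟩
    mkℚᵘ (ℤ.+ (f n + M)) n              ∎)
    where open ℚ.≤-Reasoning
  open ≤-Reasoning
  M≤C : M ≤ C
  M≤C = +-cancelˡ-≤ (f n + M) M C (begin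
    f n + M + M        ≡⟨ +-assoc (f n) M M ⟩
    f n + (M + M)      ≤⟨ gap n (M + M) (≤-reflexive (double (suc D) M)) ⟩
    g n + C            ≤⟨ +-monoˡ-≤ C g≤f+M ⟩
    f n + M + C        ∎)
    where
    double : ∀ d M → d * (M + M) ≡ 2 * d * M
    double = solve 2 (λ d M → d :* (M :+ M) := con 2 :* d :* M) refl

-- Estimates for the terms of the Sombor index

*-distribˡ-∑χ : ∀ {n} (s : Fin n → Bool) (f : Fin n → ℕ) c →
  c * (∑[ i < n ] χ (s i) * f i) ≡ ∑[ i < n ] χ (s i) * (c * f i)
*-distribˡ-∑χ s f c = trans (*-distribˡ-sum c (λ i → χ (s i) * f i)) (sum-cong-≗ λ i → swap c (χ (s i)) (f i))
  where
  swap : ∀ c x y → c * (x * y) ≡ x * (c * y)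
  swap = solve 3 (λ c x y → c :* (x :* y) := x :* (c :* y)) refl

-- p, q ≥ 1 are written 1 + p, 1 + q, and m ≥ p + q as 2 + p + q + r.
edge-slack : Bool → Bool → ℕ → ℕ → ℕ → ℕ
edge-slack true  true  p q r = 2 * p * q + 2 * p * r + 4 * r + 2 * q * r + r ^ 2
edge-slack true  false p q r = 2 * q + 4 * r + (2 * p * q + 2 * p * r + 2 * q * r + r ^ 2)
edge-slack false true  p q r = edge-slack true false q p r
edge-slack false false p q r = 1 + (2 * (1 + p) * (1 + q + r) + 2 * (1 + q) * r + r ^ 2)

-- The last summand is 1 or 4, the squared degree of a leaf in the extremal graph, where the other
-- end of a tree edge is the centre.
edge-slack-eq : ∀ a b p q r →
  (1 + p + χ a) ^ 2 + (1 + q + χ b) ^ 2 + edge-slack a b p q r ≡ (2 + p + q + r) ^ 2 + (1 + χ (a ∧ b) * 3)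
edge-slack-eq true true = solve 3 (λ p q r →
  (con 1 :+ p :+ con 1) :^ 2 :+ (con 1 :+ q :+ con 1) :^ 2
    :+ (con 2 :* p :* q :+ con 2 :* p :* r :+ con 4 :* r :+ con 2 :* q :* r :+ r :^ 2)
  := (con 2 :+ p :+ q :+ r) :^ 2 :+ con 4) refl
edge-slack-eq true false = solve 3 (λ p q r →
  (con 1 :+ p :+ con 1) :^ 2 :+ (con 1 :+ q :+ con 0) :^ 2
    :+ (con 2 :* q :+ con 4 :* r :+ (con 2 :* p :* q :+ con 2 :* p :* r :+ con 2 :* q :* r :+ r :^ 2))
  := (con 2 :+ p :+ q :+ r) :^ 2 :+ con 1) refl
edge-slack-eq false true = solve 3 (λ p q r →
  (con 1 :+ p :+ con 0) :^ 2 :+ (con 1 :+ q :+ con 1) :^ 2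
    :+ (con 2 :* p :+ con 4 :* r :+ (con 2 :* q :* p :+ con 2 :* q :* r :+ con 2 :* p :* r :+ r :^ 2))
  := (con 2 :+ p :+ q :+ r) :^ 2 :+ con 1) refl
edge-slack-eq false false = solve 3 (λ p q r →
  (con 1 :+ p :+ con 0) :^ 2 :+ (con 1 :+ q :+ con 0) :^ 2
    :+ (con 1 :+ (con 2 :* (con 1 :+ p) :* (con 1 :+ q :+ r) :+ con 2 :* (con 1 :+ q) :* r :+ r :^ 2))
  := (con 2 :+ p :+ q :+ r) :^ 2 :+ con 1) refl

-- The slack vanishes only if r = 0 and an end in N has tree degree m - 1, that is, is adjacent to
-- all others. The two hypotheses exclude this.
edge-slack>0 : ∀ a b p q r →
  (a ≡ true → 2 + p ≢ 2 + p + q + r) → (b ≡ true → 2 + q ≢ 2 + p + q + r) →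
  0 < edge-slack a b p q r
-- The leading products do not reduce here, so `shape` moves one unit of 4(1 + r) to the end.
edge-slack>0 true  true  p       q       (suc r) _  _  = ≤-trans (m≤n+m 1 _) (≤-reflexive (shape p q r))
  where
  shape : ∀ p q r → 2 * p * q + 2 * p * suc r + 3 + 4 * r + 2 * q * suc r + suc r ^ 2 + 1 ≡ edge-slack true true p q (suc r)
  shape = solve 3 (λ p q r →
    con 2 :* p :* q :+ con 2 :* p :* (con 1 :+ r) :+ con 3 :+ con 4 :* r
      :+ con 2 :* q :* (con 1 :+ r) :+ (con 1 :+ r) :^ 2 :+ con 1
    := con 2 :* p :* q :+ con 2 :* p :* (con 1 :+ r) :+ con 4 :* (con 1 :+ r)
      :+ con 2 :* q :* (con 1 :+ r) :+ (con 1 :+ r) :^ 2) refl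
edge-slack>0 true  true  zero    q       zero    _  h₂ = contradiction (sym (+-identityʳ (2 + q))) (h₂ refl)
edge-slack>0 true  true  (suc p) zero    zero    h₁ _  = contradiction (sym (trans (+-identityʳ _) (+-identityʳ _))) (h₁ refl)
edge-slack>0 true  true  (suc p) (suc q) zero    _  _  = s≤s z≤n
edge-slack>0 true  false p       zero    zero    h₁ _  = contradiction (sym (trans (+-identityʳ _) (+-identityʳ _))) (h₁ refl)
edge-slack>0 true  false p       zero    (suc r) _  _  = s≤s z≤n
edge-slack>0 true  false p       (suc q) r       _  _  = s≤s z≤n
edge-slack>0 false true  zero    q       zero    _  h₂ = contradiction (sym (+-identityʳ (2 + q))) (h₂ refl)
edge-slack>0 false true  zero    q       (suc r) _  _  = s≤s z≤n
edge-slack>0 false true  (suc p) q       r       _  _  = s≤s z≤n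
edge-slack>0 false false p       q       r       _  _  = s≤s z≤n

split-sum : ∀ {p q m} → 1 ≤ p → 1 ≤ q → p + q ≤ m →
  ∃[ p′ ] ∃[ q′ ] ∃[ r ] (p ≡ 1 + p′ × q ≡ 1 + q′ × m ≡ 2 + p′ + q′ + r)
split-sum {suc p} {suc q} {m} _ _ le =
  p , q , m ∸ (2 + p + q) , refl , refl , sym (m+[n∸m]≡n (subst (_≤ m) (cong suc (+-suc p q)) le))

edge-bound : ∀ a b {p q m} → 1 ≤ p → 1 ≤ q → p + q ≤ m →
  (p + χ a) ^ 2 + (q + χ b) ^ 2 ≤ m ^ 2 + (1 + χ (a ∧ b) * 3)
edge-bound a b 1≤p 1≤q le with split-sum 1≤p 1≤q le
... | p , q , r , refl , refl , refl = ≤-trans (m≤m+n _ _) (≤-reflexive (edge-slack-eq a b p q r))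

edge-bound-strict : ∀ a b {p q m} → 1 ≤ p → 1 ≤ q → p + q ≤ m →
  (a ≡ true → suc p ≢ m) → (b ≡ true → suc q ≢ m) →
  (p + χ a) ^ 2 + (q + χ b) ^ 2 < m ^ 2 + (1 + χ (a ∧ b) * 3)
edge-bound-strict a b 1≤p 1≤q le h₁ h₂ with split-sum 1≤p 1≤q le
... | p , q , r , refl , refl , refl =
  <-≤-trans (m<m+n _ (edge-slack>0 a b p q r h₁ h₂)) (≤-reflexive (edge-slack-eq a b p q r))

-- Multiplying by M avoids division. By `root-chord` each term lies below the chord between x = 0
-- and x = M, so only the number of terms and the sum of the x matter. The summand `suc c` collects
-- one unit of rounding per term.
vertex-sum : ∀ n k {m} (s : Fin m → Bool) (x : Fin m → ℕ) c M → 1 ≤ M →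
  ∑[ i < m ] χ (s i) ≡ suc c → (∀ i → x i ≤ M) → ∑[ i < m ] χ (s i) * x i ≤ M →
  ∑[ i < m ] χ (s i) * root n (k ^ 2 + (2 + x i) ^ 2)
    ≤ root n (k ^ 2 + (2 + M) ^ 2) + c * root n (k ^ 2 + 4) + suc c
vertex-sum n k {m} s x c M@(suc _) _ size x≤M Σx≤M = *-cancelˡ-≤ M (begin
  M * (∑[ i < m ] χ (s i) * R (x i))                      ≡⟨ *-distribˡ-∑χ s (R ∘ x) M ⟩
  (∑[ i < m ] χ (s i) * (M * R (x i)))                    ≤⟨ sum-mono (λ i → *-monoʳ-≤ (χ (s i)) (chord i)) ⟩
  (∑[ i < m ] χ (s i) * (M * r₂ + M + Δ * x i))           ≡⟨ sum-cong-≗ (λ i → distribute (χ (s i)) (M * r₂ + M) Δ (x i)) ⟩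
  (∑[ i < m ] ((M * r₂ + M) * χ (s i) + Δ * (χ (s i) * x i)))
    ≡⟨ ∑-distrib-+ (λ i → (M * r₂ + M) * χ (s i)) _ ⟩
  (∑[ i < m ] (M * r₂ + M) * χ (s i)) + (∑[ i < m ] Δ * (χ (s i) * x i))
    ≡⟨ cong₂ _+_ (sym (*-distribˡ-sum (M * r₂ + M) (χ ∘ s))) (sym (*-distribˡ-sum Δ (λ i → χ (s i) * x i))) ⟩
  (M * r₂ + M) * sum (χ ∘ s) + Δ * (∑[ i < m ] χ (s i) * x i)
    ≤⟨ +-mono-≤ (≤-reflexive (cong ((M * r₂ + M) *_) size)) (*-monoʳ-≤ Δ Σx≤M) ⟩
  (M * r₂ + M) * suc c + Δ * M                            ≡⟨ collect M r₂ c Δ ⟩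
  M * (r₂ + Δ + c * r₂ + suc c)                           ≡⟨ cong (λ z → M * (z + c * r₂ + suc c)) r₂+Δ ⟩
  M * (rₘ + c * r₂ + suc c)                               ∎)
  where
  open ≤-Reasoning
  R : ℕ → ℕ
  R x = root n (k ^ 2 + (2 + x) ^ 2)
  r₂ = root n (k ^ 2 + 4)
  rₘ = root n (k ^ 2 + (2 + M) ^ 2)
  Δ = rₘ ∸ r₂
  r₂+Δ : r₂ + Δ ≡ rₘ
  r₂+Δ = m+[n∸m]≡n (root-mono n (+-monoʳ-≤ (k ^ 2) (^-monoˡ-≤ 2 (m≤m+n 2 M))))
  chord : ∀ i → M * R (x i) ≤ M * r₂ + M + Δ * x i
  chord i = begin
    M * R (x i)                              ≤⟨ root-chord n k {x i} {M ∸ x i} x+y≡M ⟩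
    x i * rₘ + (M ∸ x i) * r₂ + M            ≡⟨ cong (λ r → x i * r + (M ∸ x i) * r₂ + M) (sym r₂+Δ) ⟩
    x i * (r₂ + Δ) + (M ∸ x i) * r₂ + M      ≡⟨ interpolate (x i) (M ∸ x i) r₂ Δ M ⟩
    (x i + (M ∸ x i)) * r₂ + M + Δ * x i     ≡⟨ cong (λ z → z * r₂ + M + Δ * x i) x+y≡M ⟩
    M * r₂ + M + Δ * x i                     ∎
    where
    x+y≡M : x i + (M ∸ x i) ≡ M
    x+y≡M = m+[n∸m]≡n (x≤M i)
    interpolate : ∀ x y r Δ M → x * (r + Δ) + y * r + M ≡ (x + y) * r + M + Δ * x
    interpolate = solve 5 (λ x y r Δ M → x :* (r :+ Δ) :+ y :* r :+ M := (x :+ y) :* r :+ M :+ Δ :* x) refl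
  distribute : ∀ b a Δ x → b * (a + Δ * x) ≡ a * b + Δ * (b * x)
  distribute = solve 4 (λ b a Δ x → b :* (a :+ Δ :* x) := a :* b :+ Δ :* (b :* x)) refl
  collect : ∀ M r c Δ → (M * r + M) * suc c + Δ * M ≡ M * (r + Δ + c * r + suc c)
  collect = solve 4 (λ M r c Δ → (M :* r :+ M) :* (con 1 :+ c) :+ Δ :* M
    := M :* (r :+ Δ :+ c :* r :+ (con 1 :+ c))) refl

-- A tree plus one vertex

other-vertex : ∀ {m} → 2 ≤ m → (i : Fin m) → ∃[ j ] i ≢ j
other-vertex (s≤s (s≤s _)) i = Fin.punchIn i zero , λ eq → Fin.punchInᵢ≢i i zero (sym eq)

-- `s` is the set of neighbours of the vertex added to T, and `suc k` its degree; `t` and `d` below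
-- are degrees in T and in the whole graph.
module TreePlusVertex {m} (T : Graph m) (tree : IsTree T) (s : Fin m → Bool) (k : ℕ)
                      (size : ∑[ i < m ] χ (s i) ≡ suc k) where
  open Graph T
  open Forest T (proj₂ tree)

  t d : Fin m → ℕ
  t i = ∑[ j < m ] adj T i j
  d i = t i + χ (s i)

  t<m : ∀ i → suc (t i) ≤ m
  t<m i = begin
    suc (t i)                                                     ≡⟨ +-comm 1 (t i) ⟩
    t i + 1                                                       ≡⟨ cong (t i +_) (sym (sum-indicator i 1)) ⟩
    t i + (∑[ j < m ] χ (does (j Fin.≟ i)) * 1)                   ≡⟨ sym (∑-distrib-+ (adj T i) _) ⟩
    (∑[ j < m ] (adj T i j + χ (does (j Fin.≟ i)) * 1))           ≤⟨ sum-mono at-most-one ⟩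
    (∑[ j < m ] 1)                                                ≡⟨ sum-ones m ⟩
    m                                                             ∎
    where
    open ≤-Reasoning
    at-most-one : ∀ j → adj T i j + χ (does (j Fin.≟ i)) * 1 ≤ 1
    at-most-one j with j Fin.≟ i
    ... | yes refl = ≤-reflexive (cong (_+ 1) (adj-irrefl T i))
    ... | no _     = ≤-trans (≤-reflexive (+-identityʳ (adj T i j))) (χ≤1 (does (i ~? j)))

  -- A common neighbour of adjacent vertices would close a triangle, so the two neighbourhoods are
  -- disjoint.
  t+t≤m : ∀ {i j} → i ~ j → t i + t j ≤ m
  t+t≤m {i} {j} i~j = begin
    t i + t j                              ≡⟨ sym (∑-distrib-+ (adj T i) (adj T j)) ⟩
    (∑[ x < m ] (adj T i x + adj T j x))   ≤⟨ sum-mono no-common ⟩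
    (∑[ x < m ] 1)                         ≡⟨ sum-ones m ⟩
    m                                      ∎
    where
    open ≤-Reasoning
    no-common : ∀ x → adj T i x + adj T j x ≤ 1
    no-common x with i ~? x | j ~? x
    ... | yes i~x | yes j~x = ⊥-elim (no-triangle i~j j~x (~-sym i~x))
    ... | yes _   | no _    = ≤-refl
    ... | no _    | yes _   = ≤-refl
    ... | no _    | no _    = z≤n

  t>0-neighbour : ∀ {i j} → i ~ j → 1 ≤ t i
  t>0-neighbour {i} {j} i~j = subst (_≤ t i) (adj-yes T i~j) (term≤sum (adj T i) j)

  first-step : ∀ {i j} → i ≢ j → Star _~_ i j → ∃[ x ] i ~ x
  first-step i≢j Star.ε    = contradiction refl i≢j
  first-step i≢j (i~x ◅ _) = _ , i~x

  neighbour : ∀ {i j} → i ≢ j → ∃[ x ] i ~ x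
  neighbour {i} {j} i≢j = first-step i≢j (proj₂ (proj₁ tree) i j)

  ∑t≤ : ∑[ i < m ] t i ≤ 2 * (m ∸ 1)
  ∑t≤ = subst (_≤ 2 * (m ∸ 1))
    (sum-cong-≗ λ i → trans (*-identityˡ _) (sum-cong-≗ λ j → *-identityˡ (adj T i j)))
    (forest m (const true) (sum-ones m))

  1≤m : 1 ≤ m
  1≤m = proj₁ (proj₁ tree)

  k<m : suc k ≤ m
  k<m = subst (_≤ m) size (∑χ≤ s)

  edge-weight : ℕ → Bool → ℕ
  edge-weight n b = root n (m ^ 2 + (1 + χ b * 3))

  edge≤ : ∀ n {i j} → i ~ j → root n (d i ^ 2 + d j ^ 2) ≤ edge-weight n (s i ∧ s j)
  edge≤ n {i} {j} i~j = root-mono n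
    (edge-bound (s i) (s j) (t>0-neighbour i~j) (t>0-neighbour (~-sym i~j)) (t+t≤m i~j))

  edge-gap : (∀ c → s c ≡ true → suc (t c) ≢ m) → ∀ n δ → 2 * (m ^ 2 + 4) * δ ≤ suc n →
    ∀ {i j} → i ~ j → root n (d i ^ 2 + d j ^ 2) + δ ≤ edge-weight n (s i ∧ s j)
  -- `2 * (m ^ 2 + 4)` is at least twice the radicand of `edge-weight` in both of its cases.
  edge-gap ¬centre n δ Dδ≤n {i} {j} i~j = root-gap n δ (2 * (m ^ 2 + 4))
    (edge-bound-strict (s i) (s j) (t>0-neighbour i~j) (t>0-neighbour (~-sym i~j)) (t+t≤m i~j) (¬centre i) (¬centre j))
    (*-monoʳ-≤ 2 (+-monoʳ-≤ (m ^ 2) (+-monoʳ-≤ 1 (*-monoˡ-≤ 3 (χ≤1 (s i ∧ s j))))))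
    Dδ≤n

  -- An edge weighs w₁, plus Δ if both ends lie in s, so `forest` for T and for s bounds the total.
  -- Every edge appears as two ordered pairs, and each pair carries its own δ.
  edge-sum : ∀ n δ → (∀ {i j} → i ~ j → root n (d i ^ 2 + d j ^ 2) + δ ≤ edge-weight n (s i ∧ s j)) →
    (∑[ i < m ] ∑[ j < m ] adj T i j * root n (d i ^ 2 + d j ^ 2)) + (∑[ i < m ] t i) * δ
      ≤ 2 * (m ∸ suc k) * root n (m ^ 2 + 1) + 2 * k * root n (m ^ 2 + 4)
  edge-sum n δ le = begin
    (∑[ i < m ] ∑[ j < m ] adj T i j * R i j) + (∑[ i < m ] t i) * δ
      ≡⟨ cong ((∑[ i < m ] ∑[ j < m ] adj T i j * R i j) +_)
           (trans (*-distribʳ-sum δ t) (sum-cong-≗ λ i → *-distribʳ-sum δ (adj T i))) ⟩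
    (∑[ i < m ] ∑[ j < m ] adj T i j * R i j) + (∑[ i < m ] ∑[ j < m ] adj T i j * δ)
      ≡⟨ sym (∑∑-+ (λ i j → adj T i j * R i j) _) ⟩
    (∑[ i < m ] ∑[ j < m ] (adj T i j * R i j + adj T i j * δ))
      ≤⟨ sum-mono (λ i → sum-mono (λ j → edge i j)) ⟩
    (∑[ i < m ] ∑[ j < m ] (w₁ * adj T i j + Δ * (χ (s i) * (χ (s j) * adj T i j))))
      ≡⟨ ∑∑-+ (λ i j → w₁ * adj T i j) _ ⟩
    (∑[ i < m ] ∑[ j < m ] w₁ * adj T i j) + (∑[ i < m ] ∑[ j < m ] Δ * (χ (s i) * (χ (s j) * adj T i j)))
      ≡⟨ sym (cong₂ _+_ (∑∑-* w₁ (adj T)) (trans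
           (cong (Δ *_) (sum-cong-≗ λ i → *-distribˡ-sum (χ (s i)) (λ j → χ (s j) * adj T i j)))
           (∑∑-* Δ (λ i j → χ (s i) * (χ (s j) * adj T i j))))) ⟩
    w₁ * (∑[ i < m ] t i) + Δ * ∣E∣ s
      ≤⟨ +-mono-≤ (*-monoʳ-≤ w₁ ∑t≤) (*-monoʳ-≤ Δ (forest (suc k) s size)) ⟩
    w₁ * (2 * (m ∸ 1)) + Δ * (2 * k)
      ≡⟨ cong (λ z → w₁ * (2 * z) + Δ * (2 * k)) m∸1≡ ⟩
    w₁ * (2 * (k + (m ∸ suc k))) + Δ * (2 * k)
      ≡⟨ regroup w₁ Δ k (m ∸ suc k) ⟩
    2 * (m ∸ suc k) * w₁ + 2 * k * (w₁ + Δ)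
      ≡⟨ cong (λ z → 2 * (m ∸ suc k) * w₁ + 2 * k * z) w₁+Δ ⟩
    2 * (m ∸ suc k) * w₁ + 2 * k * w₄ ∎
    where
    open ≤-Reasoning
    R : Fin m → Fin m → ℕ
    R i j = root n (d i ^ 2 + d j ^ 2)
    w₁ = root n (m ^ 2 + 1)
    w₄ = root n (m ^ 2 + 4)
    Δ = w₄ ∸ w₁
    w₁+Δ : w₁ + Δ ≡ w₄
    w₁+Δ = m+[n∸m]≡n (root-mono n (+-monoʳ-≤ (m ^ 2) (s≤s z≤n)))
    m∸1≡ : m ∸ 1 ≡ k + (m ∸ suc k)
    m∸1≡ = suc-injective (trans (m+[n∸m]≡n 1≤m) (sym (m+[n∸m]≡n k<m)))
    regroup : ∀ w Δ k r → w * (2 * (k + r)) + Δ * (2 * k) ≡ 2 * r * w + 2 * k * (w + Δ)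
    regroup = solve 4 (λ w Δ k r → w :* (con 2 :* (k :+ r)) :+ Δ :* (con 2 :* k)
      := con 2 :* r :* w :+ con 2 :* k :* (w :+ Δ)) refl
    ∑∑-+ : ∀ (f g : Fin m → Fin m → ℕ) →
      ∑[ i < m ] ∑[ j < m ] (f i j + g i j) ≡ (∑[ i < m ] ∑[ j < m ] f i j) + (∑[ i < m ] ∑[ j < m ] g i j)
    ∑∑-+ f g = trans (sum-cong-≗ λ i → ∑-distrib-+ (f i) (g i)) (∑-distrib-+ (λ i → ∑[ j < m ] f i j) _)
    ∑∑-* : ∀ c (f : Fin m → Fin m → ℕ) → c * (∑[ i < m ] ∑[ j < m ] f i j) ≡ ∑[ i < m ] ∑[ j < m ] c * f i j
    ∑∑-* c f = trans (*-distribˡ-sum c (λ i → ∑[ j < m ] f i j)) (sum-cong-≗ λ i → *-distribˡ-sum c (f i))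
    weight : ∀ a b → edge-weight n (a ∧ b) ≡ w₁ + Δ * (χ a * χ b)
    weight true  true  = trans (sym w₁+Δ) (cong (w₁ +_) (sym (*-identityʳ Δ)))
    weight true  false = sym (trans (cong (w₁ +_) (*-zeroʳ Δ)) (+-identityʳ w₁))
    weight false b     = sym (trans (cong (w₁ +_) (*-zeroʳ Δ)) (+-identityʳ w₁))
    spread : ∀ a w Δ x y → a * (w + Δ * (x * y)) ≡ w * a + Δ * (x * (y * a))
    spread = solve 5 (λ a w Δ x y → a :* (w :+ Δ :* (x :* y)) := w :* a :+ Δ :* (x :* (y :* a))) refl
    edge : ∀ i j → adj T i j * R i j + adj T i j * δ ≤ w₁ * adj T i j + Δ * (χ (s i) * (χ (s j) * adj T i j))
    edge i j = begin
      adj T i j * R i j + adj T i j * δ          ≡⟨ sym (*-distribˡ-+ (adj T i j) (R i j) δ) ⟩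
      adj T i j * (R i j + δ)                    ≤⟨ χ-*-mono (does (i ~? j)) (λ eq → le (witness (i ~? j) eq)) ⟩
      adj T i j * edge-weight n (s i ∧ s j)      ≡⟨ cong (adj T i j *_) (weight (s i) (s j)) ⟩
      adj T i j * (w₁ + Δ * (χ (s i) * χ (s j))) ≡⟨ spread (adj T i j) w₁ Δ (χ (s i)) (χ (s j)) ⟩
      w₁ * adj T i j + Δ * (χ (s i) * (χ (s j) * adj T i j)) ∎

  module _ (n : ℕ) where
    private
      K = suc k
      V = ∑[ i < m ] χ (s i) * root n (K ^ 2 + d i ^ 2)

    d≤m : ∀ i → d i ≤ m
    d≤m i = ≤-trans (+-monoʳ-≤ (t i) (χ≤1 (s i))) (subst (_≤ m) (+-comm 1 (t i)) (t<m i))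

    -- Serves the orders m ≤ 2, where m = 2 + M has no solution with M ≥ 1 as `vertex-sum` demands.
    crude-vertex-bound : V ≤ K * root n (K ^ 2 + m ^ 2)
    crude-vertex-bound = begin
      V
        ≤⟨ sum-mono (λ i → *-monoʳ-≤ (χ (s i)) (root-mono n (+-monoʳ-≤ (K ^ 2) (^-monoˡ-≤ 2 (d≤m i))))) ⟩
      (∑[ i < m ] χ (s i) * root n (K ^ 2 + m ^ 2))
        ≡⟨ sym (*-distribʳ-sum (root n (K ^ 2 + m ^ 2)) (χ ∘ s)) ⟩
      sum (χ ∘ s) * root n (K ^ 2 + m ^ 2)
        ≡⟨ cong (_* root n (K ^ 2 + m ^ 2)) size ⟩
      K * root n (K ^ 2 + m ^ 2) ∎
      where open ≤-Reasoning

    module _ {M} (m≡ : m ≡ 2 + M) where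
      -- The subtraction never truncates: in a connected graph on at least two vertices every vertex
      -- has a neighbour.
      x : Fin m → ℕ
      x i = t i ∸ 1

      t≡1+x : ∀ i → 1 + x i ≡ t i
      t≡1+x i =
        let _ , i≢j = other-vertex (subst (2 ≤_) (sym m≡) (s≤s (s≤s z≤n))) i
        in m+[n∸m]≡n (t>0-neighbour (proj₂ (neighbour i≢j)))

      x≤M : ∀ i → x i ≤ M
      x≤M i = +-cancelˡ-≤ 2 _ _ (subst (2 + x i ≤_) m≡ (subst (λ z → suc z ≤ m) (sym (t≡1+x i)) (t<m i)))

      -- Over all of T the sum is at most 2(m - 1) - m = M, and restricting it to s only drops
      -- terms. Adding 2 + M = m to both sides avoids the subtraction.
      ∑x≤M : ∑[ i < m ] χ (s i) * x i ≤ M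
      ∑x≤M = +-cancelˡ-≤ (2 + M) _ M (begin
        2 + M + (∑[ i < m ] χ (s i) * x i)
          ≡⟨ cong (_+ (∑[ i < m ] χ (s i) * x i)) (sym (trans (sum-ones m) m≡)) ⟩
        (∑[ i < m ] 1) + (∑[ i < m ] χ (s i) * x i)    ≡⟨ sym (∑-distrib-+ {m} (λ _ → 1) _) ⟩
        (∑[ i < m ] (1 + χ (s i) * x i))
          ≤⟨ sum-mono (λ i → ≤-trans (s≤s (χ-*-≤ (s i) (x i))) (≤-reflexive (t≡1+x i))) ⟩
        (∑[ i < m ] t i)                               ≤⟨ ∑t≤ ⟩
        2 * (m ∸ 1)                                    ≡⟨ cong (λ m → 2 * (m ∸ 1)) m≡ ⟩
        2 * (1 + M)                                    ≡⟨ double M ⟩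
        2 + M + M                                      ∎)
        where
        open ≤-Reasoning
        double : ∀ M → 2 * (1 + M) ≡ 2 + M + M
        double = solve 1 (λ M → con 2 :* (con 1 :+ M) := con 2 :+ M :+ M) refl

      d≡2+x : ∀ i → s i ≡ true → d i ≡ 2 + x i
      d≡2+x i si = trans (cong (λ b → t i + χ b) si) (trans (+-comm (t i) 1) (cong suc (sym (t≡1+x i))))

    vertex-bound : V ≤ root n (K ^ 2 + m ^ 2) + k * root n (K ^ 2 + 4) + K
    vertex-bound = by-order m refl
      where
      open ≤-Reasoning
      rₘ = root n (K ^ 2 + m ^ 2)
      -- As m is a module parameter, the case split is made on a copy of it tied by an equation.
      by-order : ∀ m′ → m ≡ m′ → V ≤ root n (K ^ 2 + m ^ 2) + k * root n (K ^ 2 + 4) + K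
      by-order zero m≡ with () ← subst (1 ≤_) m≡ 1≤m
      by-order 1 m≡ = ≤-trans crude-vertex-bound (≤-trans
        (≤-reflexive (cong (rₘ +_) (cong (_* rₘ) k≡0))) (≤-trans (+-monoʳ-≤ rₘ z≤n) (m≤m+n _ K)))
        where
        k≡0 : k ≡ 0
        k≡0 = n≤0⇒n≡0 (≤-pred (subst (K ≤_) m≡ k<m))
      -- With m = 2, k of the K crude terms √(K² + m²) are already the required √(K² + 4).
      by-order 2 m≡ = ≤-trans crude-vertex-bound (≤-trans
        (+-monoʳ-≤ rₘ (≤-reflexive (cong (λ z → k * root n (K ^ 2 + z ^ 2)) m≡)))
        (m≤m+n _ K))
      by-order (suc (suc M@(suc _))) m≡ = begin
        V
          ≡⟨ sum-cong-≗ (λ i → χ-*-cong (s i) (λ si → cong (λ z → root n (K ^ 2 + z ^ 2)) (d≡2+x m≡ i si))) ⟩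
        (∑[ i < m ] χ (s i) * root n (K ^ 2 + (2 + x m≡ i) ^ 2))
          ≤⟨ vertex-sum n K s (x m≡) k M (s≤s z≤n) size (x≤M m≡) (∑x≤M m≡) ⟩
        root n (K ^ 2 + (2 + M) ^ 2) + k * root n (K ^ 2 + 4) + K
          ≡⟨ cong (λ z → root n (K ^ 2 + z ^ 2) + k * root n (K ^ 2 + 4) + K) (sym m≡) ⟩
        root n (K ^ 2 + m ^ 2) + k * root n (K ^ 2 + 4) + K ∎

-- The Sombor index as a double sum

module _ {a p} {A : Set a} {P : Pred A p} (P? : Decidable P) (h : A → ℕ) where

  sum-filter-++ : ∀ xs ys → listSum (map h (filter P? (xs ++ ys)))
    ≡ listSum (map h (filter P? xs)) + listSum (map h (filter P? ys))
  sum-filter-++ xs ys = trans (cong (listSum ∘ map h) (filter-++ P? xs ys))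
    (trans (cong listSum (map-++ h (filter P? xs) (filter P? ys))) (sum-++ (map h (filter P? xs)) _))

  sum-filter-∷ : ∀ x xs → listSum (map h (filter P? (x ∷ xs))) ≡ χ (does (P? x)) * h x + listSum (map h (filter P? xs))
  sum-filter-∷ x xs with does (P? x)
  ... | true  = cong (_+ listSum (map h (filter P? xs))) (sym (*-identityˡ (h x)))
  ... | false = refl

  sum-filter-tabulate : ∀ {b} {B : Set b} (f : B → A) {n} (g : Fin n → B) →
    listSum (map h (filter P? (map f (List.tabulate g)))) ≡ ∑[ i < n ] χ (does (P? (f (g i)))) * h (f (g i))
  sum-filter-tabulate f {zero}  g = refl
  sum-filter-tabulate f {suc n} g = trans (sum-filter-∷ (f (g zero)) _)
    (cong (χ (does (P? (f (g zero)))) * h (f (g zero)) +_) (sum-filter-tabulate f (g ∘ suc)))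

sum-filter-product : ∀ {a b p} {A : Set a} {B : Set b} {P : Pred (A × B) p} (P? : Decidable P) (h : A × B → ℕ)
  {m n} (f : Fin m → A) (g : Fin n → B) →
  listSum (map h (filter P? (cartesianProduct (List.tabulate f) (List.tabulate g))))
    ≡ ∑[ i < m ] ∑[ j < n ] χ (does (P? (f i , g j))) * h (f i , g j)
sum-filter-product P? h {zero}  f g = refl
sum-filter-product P? h {suc m} f g = trans (sum-filter-++ P? h (map (f zero ,_) (List.tabulate g)) _)
  (cong₂ _+_ (sum-filter-tabulate P? h (f zero ,_) g) (sum-filter-product P? h (f ∘ suc) g))

module _ {n} (G : Graph n) where
  open Graph G

  SO-approx : ℕ → ℕ
  SO-approx N = listSum (map (λ (u , v) → root N (degree G u ^ 2 + degree G v ^ 2)) (edges G))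

  SO-≐ : SO G ≐ SO-approx
  SO-≐ = sumℝ-≐ (λ (u , v) → degree G u ^ 2 + degree G v ^ 2) (edges G)

  weight : ℕ → Fin n → Fin n → ℕ
  weight N i j = root N (degree G i ^ 2 + degree G j ^ 2)

  weight-sym : ∀ N i j → weight N i j ≡ weight N j i
  weight-sym N i j = cong (root N) (+-comm (degree G i ^ 2) (degree G j ^ 2))

  ordered-sum : ℕ → ℕ
  ordered-sum N = ∑[ i < n ] ∑[ j < n ] adj G i j * weight N i j

  -- `edges` keeps only pairs with u < v; adding the transposed sum supplies the other order, and
  -- the diagonal vanishes by irreflexivity.
  ordered-sum≡2SO : ∀ N → 2 * SO-approx N ≡ ordered-sum N
  ordered-sum≡2SO N = begin
    2 * SO-approx N
      ≡⟨ cong (2 *_) (sum-filter-product E? (λ (u , v) → weight N u v) id id) ⟩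
    2 * (∑[ i < n ] ∑[ j < n ] a i j)
      ≡⟨ cong ((∑[ i < n ] ∑[ j < n ] a i j) +_) (trans (+-identityʳ _) (∑-comm a)) ⟩
    (∑[ i < n ] ∑[ j < n ] a i j) + (∑[ i < n ] ∑[ j < n ] a j i)
      ≡⟨ sym (∑-distrib-+ (λ i → ∑[ j < n ] a i j) _) ⟩
    (∑[ i < n ] ((∑[ j < n ] a i j) + (∑[ j < n ] a j i)))
      ≡⟨ sum-cong-≗ (λ i → trans (sym (∑-distrib-+ (a i) _)) (sum-cong-≗ (both-orders i))) ⟩
    ordered-sum N ∎
    where
    open ≡-Reasoning
    E? : (e : Fin n × Fin n) → Dec ((proj₁ e Fin.< proj₂ e) × (proj₁ e ~ proj₂ e))
    E? (u , v) = (u Fin.<? v) ×-dec (u ~? v)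
    a : Fin n → Fin n → ℕ
    a i j = χ (does (E? (i , j))) * weight N i j
    upper : ∀ {i j} → i Fin.< j → a i j ≡ adj G i j * weight N i j
    upper {i} {j} i<j = cong (λ b → χ (b ∧ does (i ~? j)) * weight N i j) (dec-true (i Fin.<? j) i<j)
    lower : ∀ {i j} → ¬ i Fin.< j → a i j ≡ 0
    lower {i} {j} i≮j = cong (λ b → χ (b ∧ does (i ~? j)) * weight N i j) (dec-false (i Fin.<? j) i≮j)
    both-orders : ∀ i j → a i j + a j i ≡ adj G i j * weight N i j
    both-orders i j with Fin.<-cmp i j
    ... | tri< i<j _ j≮i = trans (cong₂ _+_ (upper i<j) (lower j≮i)) (+-identityʳ _)
    ... | tri> i≮j _ j<i = trans (cong₂ _+_ (lower i≮j) (upper j<i)) (cong₂ _*_ (adj-sym G j i) (weight-sym N j i))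
    ... | tri≈ i≮i refl _ = trans (cong₂ _+_ (lower i≮i) (lower i≮i)) (sym (cong (_* weight N i i) (adj-irrefl G i)))

-- Splitting off a vertex

module _ {m} (G : Graph (suc m)) (u : Fin (suc m)) where
  open Graph G

  neighbours : Fin m → Bool
  neighbours i = does (u ~? punchIn u i)

  degree-apex : degree G u ≡ ∑[ i < m ] χ (neighbours i)
  degree-apex = trans (degree-sum G u) (trans (sum-remove {i = u} (adj G u))
    (cong (_+ (∑[ i < m ] χ (neighbours i))) (adj-irrefl G u)))

  degree-rest : ∀ i → degree G (punchIn u i) ≡ (∑[ j < m ] adj (G ∖ u) i j) + χ (neighbours i)
  degree-rest i = trans (degree-sum G (punchIn u i)) (trans (sum-remove {i = u} (adj G (punchIn u i)))
    (trans (+-comm _ (∑[ j < m ] adj (G ∖ u) i j)) (cong ((∑[ j < m ] adj (G ∖ u) i j) +_) (adj-sym G (punchIn u i) u))))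

  -- The row and the column of u agree by symmetry, whence the factor 2, and their common diagonal
  -- entry is 0.
  ordered-sum-∖ : ∀ N → ordered-sum G N ≡
    2 * (∑[ i < m ] χ (neighbours i) * weight G N u (punchIn u i))
      + (∑[ i < m ] ∑[ j < m ] adj (G ∖ u) i j * weight G N (punchIn u i) (punchIn u j))
  ordered-sum-∖ N = begin
    ordered-sum G N
      ≡⟨ sum-remove {i = u} (λ i → ∑[ j < suc m ] a i j) ⟩
    (∑[ j < suc m ] a u j) + (∑[ i < m ] ∑[ j < suc m ] a (p i) j)
      ≡⟨ cong₂ _+_ (trans (sum-remove {i = u} (a u)) (cong (λ z → z * weight G N u u + V) (adj-irrefl G u)))
           (trans (sum-cong-≗ λ i → sum-remove {i = u} (a (p i))) (∑-distrib-+ (λ i → a (p i) u) _)) ⟩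
    V + ((∑[ i < m ] a (p i) u) + (∑[ i < m ] ∑[ j < m ] a (p i) (p j)))
      ≡⟨ cong (λ z → V + (z + (∑[ i < m ] ∑[ j < m ] a (p i) (p j))))
           (sum-cong-≗ λ i → cong₂ _*_ (adj-sym G (p i) u) (weight-sym G N (p i) u)) ⟩
    V + (V + (∑[ i < m ] ∑[ j < m ] a (p i) (p j)))
      ≡⟨ twice V _ ⟩
    2 * V + (∑[ i < m ] ∑[ j < m ] a (p i) (p j)) ∎
    where
    open ≡-Reasoning
    p = punchIn u
    a : Fin (suc m) → Fin (suc m) → ℕ
    a i j = adj G i j * weight G N i j
    V = ∑[ i < m ] a u (p i)
    twice : ∀ v w → v + (v + w) ≡ 2 * v + w
    twice = solve 2 (λ v w → v :+ (v :+ w) := con 2 :* v :+ w) refl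

-- Invariance under isomorphism

module _ {m n} {G : Graph m} {H : Graph n} (iso : G ≅ H) where
  open _≅_ iso
  private
    f = Inverse.to bijection

  adj-iso : ∀ i j → adj G i j ≡ adj H (f i) (f j)
  adj-iso i j with Graph._~?_ G i j | Graph._~?_ H (f i) (f j)
  ... | yes _ | yes _ = refl
  ... | no  _ | no  _ = refl
  ... | yes p | no ¬q = contradiction (Equivalence.to (adjacency i j) p) ¬q
  ... | no ¬p | yes q = contradiction (Equivalence.from (adjacency i j) q) ¬p

  degree-iso : ∀ i → degree G i ≡ degree H (f i)
  degree-iso i = trans (degree-sum G i) (trans (sum-cong-≗ (adj-iso i))
    (trans (sym (∑-permute (adj H (f i)) bijection)) (sym (degree-sum H (f i)))))

  ordered-sum-iso : ∀ N → ordered-sum G N ≡ ordered-sum H N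
  ordered-sum-iso N = trans
    (sum-cong-≗ λ i → trans
      (sum-cong-≗ λ j → cong₂ _*_ (adj-iso i j) (cong₂ (λ x y → root N (x ^ 2 + y ^ 2)) (degree-iso i) (degree-iso j)))
      (sym (∑-permute (λ j → adj H (f i) j * weight H N (f i) j) bijection)))
    (sym (∑-permute (λ i → ∑[ j < n ] adj H i j * weight H N i j) bijection))

-- The Sombor index of the extremal graph

count-< : ∀ {c l} → c ≤ l → ∑[ i < l ] χ (does (toℕ i <? c)) ≡ c
count-< {zero}  {l}     _         = sum-zero {l} (λ _ → refl)
count-< {suc c} {suc l} (s≤s c≤l) = cong suc (count-< c≤l)

-- n - 1 and k are written 1 + m and 1 + k.
SO-bound : ℕ → ℕ → ℕ → ℕ
SO-bound m k N = (m ∸ k) * root N (suc m ^ 2 + 1)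
               + k * (root N (suc k ^ 2 + 4) + root N (suc m ^ 2 + 4))
               + root N (suc k ^ 2 + suc m ^ 2)

ordered-sum-Q : ∀ m k → k ≤ m → ∀ N → ordered-sum (Q (suc (suc m)) (suc k)) N ≡ 2 * SO-bound m k N
ordered-sum-Q m k k≤m N = begin
  ordered-sum H N
    ≡⟨ ordered-sum-∖ H zero N ⟩
  -- The adjacencies are evaluated: the apex meets the centre and the leaves selected by `b`, and in
  -- the star only the row and the column of the centre survive.
  2 * (1 * weight H N zero (suc zero) + (∑[ i < m ] χ (b i) * weight H N zero (suc (suc i))))
    + ((0 + (∑[ j < m ] 1 * weight H N (suc zero) (suc (suc j))))
       + (∑[ i < m ] (1 * weight H N (suc (suc i)) (suc zero) + (∑[ j < m ] 0))))
    ≡⟨ cong₂ (λ x y → 2 * x + y) 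
         (cong₂ _+_ apex-centre (trans (sum-cong-≗ apex-leaf) (trans
           (sym (*-distribʳ-sum rₖ₄ (χ ∘ b))) (cong (_* rₖ₄) (count-< k≤m)))))
         (cong₂ _+_ (sum-cong-≗ λ j → trans (*-identityˡ _) (centre-leaf j))
                    (sum-cong-≗ λ i → trans
                       (cong₂ _+_ (*-identityˡ (weight H N (suc (suc i)) (suc zero))) (sum-zero {m} λ _ → refl))
                       (trans (+-identityʳ _) (trans (weight-sym H N (suc (suc i)) (suc zero)) (centre-leaf i))))) ⟩
  2 * (rₖₘ + k * rₖ₄) + (L + L)
    ≡⟨ cong (λ z → 2 * (rₖₘ + k * rₖ₄) + (z + z)) L≡ ⟩
  2 * (rₖₘ + k * rₖ₄) + (((m ∸ k) * r₁ + k * r₄) + ((m ∸ k) * r₁ + k * r₄))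
    ≡⟨ collect rₖₘ k rₖ₄ (m ∸ k) r₁ r₄ ⟩
  2 * SO-bound m k N ∎
  where
  open ≡-Reasoning
  H = Q (suc (suc m)) (suc k)
  b : Fin m → Bool
  b i = does (toℕ i <? k)
  r₁ = root N (suc m ^ 2 + 1)
  r₄ = root N (suc m ^ 2 + 4)
  Δ = r₄ ∸ r₁
  rₖ₄ = root N (suc k ^ 2 + 4)
  rₖₘ = root N (suc k ^ 2 + suc m ^ 2)
  r₁+Δ : r₁ + Δ ≡ r₄
  r₁+Δ = m+[n∸m]≡n (root-mono N (+-monoʳ-≤ (suc m ^ 2) (s≤s z≤n)))
  deg-apex : degree H zero ≡ suc k
  deg-apex = trans (degree-apex H zero) (count-< (s≤s k≤m))
  deg-centre : degree H (suc zero) ≡ suc m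
  deg-centre = trans (degree-rest H zero zero) (trans (+-comm _ 1) (cong suc (sum-ones m)))
  deg-leaf : ∀ i → degree H (suc (suc i)) ≡ 1 + χ (b i)
  deg-leaf i = trans (degree-rest H zero (suc i)) (cong (λ z → suc z + χ (b i)) (sum-zero {m} λ _ → refl))
  apex-centre : 1 * weight H N zero (suc zero) ≡ rₖₘ
  apex-centre = trans (*-identityˡ _) (cong₂ (λ x y → root N (x ^ 2 + y ^ 2)) deg-apex deg-centre)
  apex-leaf : ∀ i → χ (b i) * weight H N zero (suc (suc i)) ≡ χ (b i) * rₖ₄
  apex-leaf i = χ-*-cong (b i) λ bi → cong₂ (λ x y → root N (x ^ 2 + y ^ 2)) deg-apex (trans (deg-leaf i) (cong (suc ∘ χ) bi))
  leaf-weight : ∀ c → root N (suc m ^ 2 + (1 + χ c) ^ 2) ≡ r₁ + χ c * Δ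
  leaf-weight true  = trans (sym r₁+Δ) (cong (r₁ +_) (sym (*-identityˡ Δ)))
  leaf-weight false = sym (+-identityʳ r₁)
  centre-leaf : ∀ j → weight H N (suc zero) (suc (suc j)) ≡ r₁ + χ (b j) * Δ
  centre-leaf j = trans (cong₂ (λ x y → root N (x ^ 2 + y ^ 2)) deg-centre (deg-leaf j)) (leaf-weight (b j))
  L = ∑[ j < m ] (r₁ + χ (b j) * Δ)
  split : ∀ k d r Δ → (k + d) * r + k * Δ ≡ d * r + k * (r + Δ)
  split = solve 4 (λ k d r Δ → (k :+ d) :* r :+ k :* Δ := d :* r :+ k :* (r :+ Δ)) refl
  L≡ : L ≡ (m ∸ k) * r₁ + k * r₄
  L≡ = begin
    L ≡⟨ ∑-distrib-+ (λ _ → r₁) (λ j → χ (b j) * Δ) ⟩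
    (∑[ j < m ] r₁) + (∑[ j < m ] χ (b j) * Δ)
      ≡⟨ cong₂ _+_ (sum-const m r₁) (trans (sym (*-distribʳ-sum Δ (χ ∘ b))) (cong (_* Δ) (count-< k≤m))) ⟩
    m * r₁ + k * Δ                 ≡⟨ cong (λ z → z * r₁ + k * Δ) (sym (m+[n∸m]≡n k≤m)) ⟩
    (k + (m ∸ k)) * r₁ + k * Δ     ≡⟨ split k (m ∸ k) r₁ Δ ⟩
    (m ∸ k) * r₁ + k * (r₁ + Δ)    ≡⟨ cong (λ z → (m ∸ k) * r₁ + k * z) r₁+Δ ⟩
    (m ∸ k) * r₁ + k * r₄          ∎
  collect : ∀ a k c d e f → 2 * (a + k * c) + ((d * e + k * f) + (d * e + k * f)) ≡ 2 * (d * e + k * (c + f) + a)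
  collect = solve 6 (λ a k c d e f → con 2 :* (a :+ k :* c) :+ ((d :* e :+ k :* f) :+ (d :* e :+ k :* f))
    := con 2 :* (d :* e :+ k :* (c :+ f) :+ a)) refl

-- The extremal graph

insert-self : ∀ {m n} i j (π : Permutation m n) → insert i j π ⟨$⟩ʳ i ≡ j
insert-self i j π with i Fin.≟ i
... | yes _  = refl
... | no i≢i = contradiction refl i≢i

toℕ-punchIn-fromℕ : ∀ {n} (i : Fin n) → toℕ (punchIn (fromℕ n) i) ≡ toℕ i
toℕ-punchIn-fromℕ zero    = refl
toℕ-punchIn-fromℕ (suc i) = cong suc (toℕ-punchIn-fromℕ i)

all-true : ∀ {l} (b : Fin l → Bool) → ∑[ i < l ] χ (b i) ≡ l → ∀ i → b i ≡ true
all-true {suc l} b full i with b zero in b0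
... | false = contradiction (≤-reflexive (sym full)) (<⇒≱ (s≤s (∑χ≤ (b ∘ suc))))
all-true {suc l} b full zero    | true = b0
all-true {suc l} b full (suc i) | true = all-true (b ∘ suc) (suc-injective full) i

-- Moves the leaves adjacent to u to the front, where `Q` has them. By induction a true head stays
-- first, while a false head is sent to the last place, which is beyond the count.
sorting : ∀ {l} (b : Fin l → Bool) →
  ∃ λ (π : Permutation l l) → ∀ i → b i ≡ does (toℕ (π ⟨$⟩ʳ i) <? (∑[ j < l ] χ (b j)))
sorting {zero}  b = idₚ , λ ()
sorting {suc l} b with sorting (b ∘ suc) | b zero in b0
... | π , sorted | true  = lift₀ π , λ { zero → b0 ; (suc i) → sorted i }
... | π , sorted | false = insert zero (fromℕ l) π ,
  λ { zero → trans b0 (sym zero-last) ; (suc i) → trans (sorted i) (sym (shift i)) }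
  where
  c = ∑[ j < l ] χ (b (suc j))
  zero-last : does (toℕ (insert zero (fromℕ l) π ⟨$⟩ʳ zero) <? c) ≡ false
  zero-last = trans (cong (λ x → does (toℕ x <? c)) (insert-self zero (fromℕ l) π))
    (dec-false (toℕ (fromℕ l) <? c) (≤⇒≯ (subst (c ≤_) (sym (Fin.toℕ-fromℕ l)) (∑χ≤ (b ∘ suc)))))
  shift : ∀ i → does (toℕ (insert zero (fromℕ l) π ⟨$⟩ʳ suc i) <? c) ≡ does (toℕ (π ⟨$⟩ʳ i) <? c)
  shift i = cong (λ x → does (x <? c))
    (trans (cong toℕ (insert-punchIn zero (fromℕ l) π i)) (toℕ-punchIn-fromℕ (π ⟨$⟩ʳ i)))

module _ {m} (G : Graph (suc (suc m))) (u : Fin (suc (suc m))) (acyclic : Acyclic (G ∖ u))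
         (c : Fin (suc m)) (u~c : neighbours G u c ≡ true)
         (full : ∑[ j < suc m ] adj (G ∖ u) c j ≡ m) where
  open Graph G
  open Forest (G ∖ u) acyclic using (no-triangle)

  -- A view of the vertices by their place in `Q`, which reduces the comparison of adjacencies to
  -- finitely many cases.
  data Role : Fin (suc (suc m)) → Set where
    apex   : Role u
    centre : Role (punchIn u c)
    leaf   : ∀ i → Role (punchIn u (punchIn c i))

  role : ∀ x → Role x
  role x with u Fin.≟ x
  ... | yes refl = apex
  ... | no u≢x with c Fin.≟ punchOut u≢x
  ...   | yes c≡  = subst Role (trans (cong (punchIn u) c≡) (Fin.punchIn-punchOut u≢x)) centre
  ...   | no  c≢  = subst Role
    (trans (cong (punchIn u) (Fin.punchIn-punchOut c≢)) (Fin.punchIn-punchOut u≢x)) (leaf (punchOut c≢))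

  centre~leaf : ∀ i → does (punchIn u c ~? punchIn u (punchIn c i)) ≡ true
  centre~leaf = all-true _ (trans (sym (trans (sum-remove {i = c} (adj (G ∖ u) c))
    (cong (_+ (∑[ i < m ] adj (G ∖ u) c (punchIn c i))) (adj-irrefl (G ∖ u) c)))) full)

  -- Two adjacent leaves would form a triangle with the centre.
  leaf≁leaf : ∀ i j → does (punchIn u (punchIn c i) ~? punchIn u (punchIn c j)) ≡ false
  leaf≁leaf i j = dec-false (_ ~? _) λ i~j →
    no-triangle (witness (_ ~? _) (centre~leaf i)) i~j (~-sym (witness (_ ~? _) (centre~leaf j)))

  leaf-count : ℕ
  leaf-count = ∑[ i < m ] χ (neighbours G u (punchIn c i))

  degree-apex-leaves : degree G u ≡ suc leaf-count
  degree-apex-leaves = trans (degree-apex G u) (trans (sum-remove {i = c} (χ ∘ neighbours G u))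
    (cong (λ b → χ b + leaf-count) u~c))

  private
    π = proj₁ (sorting (neighbours G u ∘ punchIn c))
    σ = insert c zero π
    ρ = insert u zero σ
    -- With the degree written as a successor, the test `toℕ i <? k` in `Q` reduces to true at the
    -- centre and to the comparison with `leaf-count` at the leaves.
    H = Q (suc (suc m)) (suc leaf-count)
    _~ᵇ_ : Fin (suc (suc m)) → Fin (suc (suc m)) → Bool
    x ~ᵇ y = does (x ~? y)
    _~ᴴ_ : Fin (suc (suc m)) → Fin (suc (suc m)) → Bool
    x ~ᴴ y = does (Graph._~?_ H x y)

  ρ-apex : ρ ⟨$⟩ʳ u ≡ zero
  ρ-apex = insert-self u zero σ

  ρ-centre : ρ ⟨$⟩ʳ punchIn u c ≡ suc zero
  ρ-centre = trans (insert-punchIn u zero σ c) (cong suc (insert-self c zero π))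

  ρ-leaf : ∀ i → ρ ⟨$⟩ʳ punchIn u (punchIn c i) ≡ suc (suc (π ⟨$⟩ʳ i))
  ρ-leaf i = trans (insert-punchIn u zero σ (punchIn c i)) (cong suc (insert-punchIn c zero π i))

  Preserved : Fin (suc (suc m)) → Fin (suc (suc m)) → Set
  Preserved x y = x ~ᵇ y ≡ (ρ ⟨$⟩ʳ x) ~ᴴ (ρ ⟨$⟩ʳ y)

  flip : ∀ x y → Preserved x y → Preserved y x
  flip x y eq = trans (does-sym G y x) (trans eq (does-sym H (ρ ⟨$⟩ʳ x) (ρ ⟨$⟩ʳ y)))

  irreflexive : ∀ x → Preserved x x
  irreflexive x = trans (dec-false (x ~? x) (~-irrefl refl))
    (sym (dec-false (Graph._~?_ H (ρ ⟨$⟩ʳ x) (ρ ⟨$⟩ʳ x)) (Graph.~-irrefl H {ρ ⟨$⟩ʳ x} refl)))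

  apex-centre : Preserved u (punchIn u c)
  apex-centre rewrite ρ-apex | ρ-centre = u~c

  apex-leaf : ∀ i → Preserved u (punchIn u (punchIn c i))
  apex-leaf i rewrite ρ-apex | ρ-leaf i = proj₂ (sorting (neighbours G u ∘ punchIn c)) i

  centre-leaf : ∀ i → Preserved (punchIn u c) (punchIn u (punchIn c i))
  centre-leaf i rewrite ρ-centre | ρ-leaf i = centre~leaf i

  leaf-leaf : ∀ i j → Preserved (punchIn u (punchIn c i)) (punchIn u (punchIn c j))
  leaf-leaf i j rewrite ρ-leaf i | ρ-leaf j = leaf≁leaf i j

  preserved : ∀ {x y} → Role x → Role y → Preserved x y
  preserved apex     apex     = irreflexive u
  preserved apex     centre   = apex-centre
  preserved apex     (leaf i) = apex-leaf i
  preserved centre   apex     = flip u (punchIn u c) apex-centre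
  preserved centre   centre   = irreflexive (punchIn u c)
  preserved centre   (leaf i) = centre-leaf i
  preserved (leaf i) apex     = flip u (punchIn u (punchIn c i)) (apex-leaf i)
  preserved (leaf i) centre   = flip (punchIn u c) (punchIn u (punchIn c i)) (centre-leaf i)
  preserved (leaf i) (leaf j) = leaf-leaf i j

  ≅Q : G ≅ Q (suc (suc m)) (degree G u)
  ≅Q = subst (λ k → G ≅ Q (suc (suc m)) k) (sym degree-apex-leaves) record
    { bijection = ρ
    ; adjacency = λ x y → mk⇔
        (λ x~y → witness (Graph._~?_ H (ρ ⟨$⟩ʳ x) (ρ ⟨$⟩ʳ y))
          (trans (sym (preserved (role x) (role y))) (dec-true (x ~? y) x~y)))
        (λ ρx~ρy → witness (x ~? y)
          (trans (preserved (role x) (role y)) (dec-true (Graph._~?_ H (ρ ⟨$⟩ʳ x) (ρ ⟨$⟩ʳ y)) ρx~ρy)))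
    }

-- The bound and its equality case

-- G has order 2 + m and degree 1 + k at u, so the tree has order 1 + m.
module QuasiTree {m k} (G : Graph (suc (suc m))) (u : Fin (suc (suc m)))
                 (tree : IsTree (G ∖ u)) (deg-u : degree G u ≡ suc k) where

  s = neighbours G u

  size : ∑[ i < suc m ] χ (s i) ≡ suc k
  size = trans (sym (degree-apex G u)) deg-u

  open TreePlusVertex (G ∖ u) tree s k size

  SO-split : ∀ N → 2 * SO-approx G N ≡
    2 * (∑[ i < suc m ] χ (s i) * root N (suc k ^ 2 + d i ^ 2))
      + (∑[ i < suc m ] ∑[ j < suc m ] adj (G ∖ u) i j * root N (d i ^ 2 + d j ^ 2))
  SO-split N = trans (ordered-sum≡2SO G N) (trans (ordered-sum-∖ G u N) (cong₂ (λ x y → 2 * x + y)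
    (sum-cong-≗ λ i → cong (χ (s i) *_) (cong₂ radius deg-u (degree-rest G u i)))
    (sum-cong-≗ λ i → sum-cong-≗ λ j →
      cong (adj (G ∖ u) i j *_) (cong₂ radius (degree-rest G u i) (degree-rest G u j)))))
    where
    radius : ℕ → ℕ → ℕ
    radius x y = root N (x ^ 2 + y ^ 2)

  -- Serves both halves: δ = 0 gives the inequality, and a positive δ gives strictness.
  SO-upper : ∀ N δ →
    (∀ {i j} → Graph._~_ (G ∖ u) i j → root N (d i ^ 2 + d j ^ 2) + δ ≤ edge-weight N (s i ∧ s j)) →
    2 * SO-approx G N + (∑[ i < suc m ] t i) * δ ≤ 2 * (SO-bound m k N + suc k)
  SO-upper N δ edge = begin
    2 * SO-approx G N + (∑[ i < suc m ] t i) * δ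
      ≡⟨ trans (cong (_+ (∑[ i < suc m ] t i) * δ) (SO-split N)) (+-assoc (2 * V) E _) ⟩
    2 * V + (E + (∑[ i < suc m ] t i) * δ)
      ≤⟨ +-mono-≤ (*-monoʳ-≤ 2 (vertex-bound N)) (edge-sum N δ edge) ⟩
    2 * (rₖₘ + k * rₖ₄ + suc k) + (2 * (m ∸ k) * r₁ + 2 * k * r₄)
      ≡⟨ collect rₖₘ k rₖ₄ (m ∸ k) r₁ r₄ ⟩
    2 * (SO-bound m k N + suc k) ∎
    where
    open ≤-Reasoning
    V = ∑[ i < suc m ] χ (s i) * root N (suc k ^ 2 + d i ^ 2)
    E = ∑[ i < suc m ] ∑[ j < suc m ] adj (G ∖ u) i j * root N (d i ^ 2 + d j ^ 2)
    r₁ = root N (suc m ^ 2 + 1)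
    r₄ = root N (suc m ^ 2 + 4)
    rₖ₄ = root N (suc k ^ 2 + 4)
    rₖₘ = root N (suc k ^ 2 + suc m ^ 2)
    collect : ∀ a k c d e f → 2 * (a + k * c + suc k) + (2 * d * e + 2 * k * f) ≡ 2 * (d * e + k * (c + f) + a + suc k)
    collect = solve 6 (λ a k c d e f → con 2 :* (a :+ k :* c :+ (con 1 :+ k)) :+ (con 2 :* d :* e :+ con 2 :* k :* f)
      := con 2 :* (d :* e :+ k :* (c :+ f) :+ a :+ (con 1 :+ k))) refl

  SO-approx≤ : ∀ N → SO-approx G N ≤ SO-bound m k N + suc k
  SO-approx≤ N = *-cancelˡ-≤ 2 (≤-trans (m≤m+n _ _)
    (SO-upper N 0 λ i~j → ≤-trans (≤-reflexive (+-identityʳ _)) (edge≤ N i~j)))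

  -- Without a universal neighbour in N(u), every edge of the tree loses δ, and
  -- the tree has an edge.
  SO-gap : (∀ c → s c ≡ true → suc (t c) ≢ suc m) → ∀ N δ → 2 * (2 * (suc m ^ 2 + 4)) * δ ≤ suc N →
    SO-approx G N + δ ≤ SO-bound m k N + suc k
  SO-gap ¬centre N δ Dδ≤N = *-cancelˡ-≤ 2 (begin
    2 * (SO-approx G N + δ)                             ≡⟨ *-distribˡ-+ 2 (SO-approx G N) δ ⟩
    2 * SO-approx G N + 2 * δ                           ≡⟨ cong (2 * SO-approx G N +_) (sym (*-identityˡ (2 * δ))) ⟩
    -- A single ordered pair is retained, so it has to lose 2δ for δ to survive the halving; hence
    -- the additional factor 2 in the hypothesis on N.
    2 * SO-approx G N + 1 * (2 * δ)                     ≤⟨ +-monoʳ-≤ (2 * SO-approx G N) (*-monoˡ-≤ (2 * δ) has-edge) ⟩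
    2 * SO-approx G N + (∑[ i < suc m ] t i) * (2 * δ)
      ≤⟨ SO-upper N (2 * δ) (edge-gap ¬centre N (2 * δ) (subst (_≤ suc N) (reassoc (suc m ^ 2 + 4) δ) Dδ≤N)) ⟩
    2 * (SO-bound m k N + suc k)                        ∎)
    where
    open ≤-Reasoning
    reassoc : ∀ a δ → 2 * (2 * a) * δ ≡ 2 * a * (2 * δ)
    reassoc = solve 2 (λ a δ → con 2 :* (con 2 :* a) :* δ := con 2 :* a :* (con 2 :* δ)) refl
    -- A tree with one vertex is excluded because that vertex, of degree 0, would be universal.
    2≤order : ∀ {c} → suc (t c) ≢ suc m → 2 ≤ suc m
    2≤order {c} t≢ = s≤s (n≢0⇒n>0 λ m≡0 → t≢ (trans
      (cong suc (n≤0⇒n≡0 (subst (t c ≤_) m≡0 (≤-pred (t<m c)))))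
      (cong suc (sym m≡0))))
    has-edge : 1 ≤ ∑[ i < suc m ] t i
    has-edge =
      let c , sc = Forest.nonempty (G ∖ u) (proj₂ tree) s size
          _ , c≢j = other-vertex (2≤order {c} (¬centre c sc)) c
      in ≤-trans (t>0-neighbour (proj₂ (neighbour c≢j))) (term≤sum t c)

  -- A search decides whether N(u) contains a universal vertex of the tree. If so, it is the centre
  -- of a star; if not, `SO-gap` separates the two reals.
  equality-case : ∀ {y} → y ≐ SO-bound m k → SO G ≈ℝ y → G ≅ Q (suc (suc m)) (suc k)
  equality-case y≐ SO≈y with Fin.any? (λ c → (s c Bool.≟ true) ×-dec (t c ℕ.≟ m))
  ... | yes (c , u~c , full) = subst (λ k → G ≅ Q (suc (suc m)) k) deg-u (≅Q G u (proj₂ tree) c u~c full)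
  ... | no ¬centre = contradiction SO≈y (≐⇒¬≈ℝ (suc k) D (SO-≐ G) y≐ λ N δ Dδ<N →
      SO-gap (λ c sc eq → ¬centre (c , sc , suc-injective eq)) N δ (≤-trans (m≤n+m (D * δ) δ) Dδ<N))
    where
    D = 2 * (2 * (suc m ^ 2 + 4))

  extremal : k ≤ m → ∀ {y} → y ≐ SO-bound m k → (SO G ≤ℝ y) × (SO G ≈ℝ y ⇔ G ≅ Q (suc (suc m)) (suc k))
  extremal k≤m {y} y≐ =
    ≐⇒≤ℝ {SO G} {y} (suc k) (SO-≐ G) y≐ SO-approx≤ ,
    -- For the converse, the approximations agree exactly at every N.
    mk⇔ (equality-case {y} y≐) λ G≅Q → ≐⇒≈ℝ {SO G} {y} (SO-≐ G) y≐ λ N →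
      *-cancelˡ-≡ (SO-approx G N) (SO-bound m k N) 2
        (trans (ordered-sum≡2SO G N) (trans (ordered-sum-iso G≅Q N) (ordered-sum-Q m k k≤m N)))

-- Unlike SO-bound, this follows the paper's formula literally.
bound-approx : ℕ → ℕ → ℕ → ℕ
bound-approx n k N = (n ∸ k ∸ 1) * root N ((n ∸ 1) ^ 2 + 1)
                   + (k ∸ 1) * (root N (k ^ 2 + 4) + root N ((n ∸ 1) ^ 2 + 4))
                   + root N (k ^ 2 + (n ∸ 1) ^ 2)

bound-approx≡SO-bound : ∀ m k N → bound-approx (suc (suc m)) (suc k) N ≡ SO-bound m k N
bound-approx≡SO-bound m k N = cong
  (λ c → c * root N (suc m ^ 2 + 1) + k * (root N (suc k ^ 2 + 4) + root N (suc m ^ 2 + 4))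
           + root N (suc k ^ 2 + suc m ^ 2))
  (trans (∸-+-assoc (suc m) k 1) (cong (suc m ∸_) (+-comm k 1)))

-- The bound enters as an arbitrary real y known only by its approximations. The orders 0 and 1 are
-- excluded by 1 ≤ k ≤ n - 1.
SO-extremal : (n k : ℕ) → 1 ≤ k → k ≤ n ∸ 1 → (G : Graph n) → G ∈𝒬[ k ] →
  ∀ {y} → y ≐ bound-approx n k → (SO G ≤ℝ y) × (SO G ≈ℝ y ⇔ G ≅ Q n k)
SO-extremal zero          (suc k) _ () _ _
SO-extremal (suc zero)    (suc k) _ () _ _
SO-extremal (suc (suc m)) (suc k) _ (s≤s k≤m) G (_ , u , tree , deg-u) y≐ =
  QuasiTree.extremal G u tree deg-u k≤m (≐-cong y≐ (bound-approx≡SO-bound m k))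

theorem3p1 : (n k : ℕ) → 1 ≤ k → k ≤ n ∸ 1 →
    (G : Graph n) → G ∈𝒬[ k ] →
    let bound = (n ∸ k ∸ 1) · √ ((n ∸ 1) ^ 2 + 1)
                +ℝ (k ∸ 1) · (√ (k ^ 2 + 4) +ℝ √ ((n ∸ 1) ^ 2 + 4))
                +ℝ √ (k ^ 2 + (n ∸ 1) ^ 2)
    in (SO G ≤ℝ bound) × (SO G ≈ℝ bound ⇔ G ≅ Q n k)
theorem3p1 n k 1≤k k≤n∸1 G G∈𝒬 = SO-extremal n k 1≤k k≤n∸1 G G∈𝒬
  (combination-≐ (n ∸ k ∸ 1) (k ∸ 1) ((n ∸ 1) ^ 2 + 1) (k ^ 2 + 4) ((n ∸ 1) ^ 2 + 4) (k ^ 2 + (n ∸ 1) ^ 2))
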